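{- Let $P$ be an $SP$-poset. Then for every $n\ge 0$ the coefficient of $x^n$ in $ldd\mathcal{SH}(P)$ is the number of left deck-divider shuffles between $P$ and $\langle n\rangle$.
   Context: Posets are finite. $\langle n\rangle$ is the chain $1<2<\cdots<n$ ($\langle 0\rangle$ is empty). An $SP$-poset is a poset obtained from one-point posets by finitely many applications of disjoint union and ordinal sum. The integers $d_{P,i}$ are defined by $\Omega^\circ(P,x)=\sum_{i=1}^{|P|}d_{P,i}\binom{x}{i}$, where $\Omega^\circ(P,n)$ is the number of strict order-preserving maps $P\to\langle n\rangle$. The left deck-divider shuffle series is $$ldd\mathcal{SH}(P)=\sum_{i=1}^{|P|}d_{P,i}\frac{x^{i+1}}{(1-x)^{i+1}}.$$ A (colimit-indexing) shuffle of $P$ and $\langle n\rangle$ is a finite poset $A$ such that: every point of $A$ is labeled by a point of $P$ or a point of $\langle n\rangle$; $A$ has the same number of minimal points as $P$ and the same number of maximal points as $P$; and there is a bijection $M\mapsto A_M$ from maximal chains of $P$ to maximal chains of $A$ such that the labels along $A_M$ list every element of $M$ and every element of $\langle n\rangle$ exactly once, preserving the order of $M$ and of $\langle n\rangle$. Every point of $P$ labels exactly one point of $A$ (a point of $\langle n\rangle$ may label several), and two shuffles are identified if for every $M$ the label sequences along the corresponding chains coincide. A left deck-divider shuffle between $P$ and $\langle n\rangle$ is a colimit-indexing shuffle $A$ such that for every maximal chain $m\subset A$, the maximum and minimum points of $m$ are points labeled by $\langle n\rangle$, and no two consecutive points of $m$ are labeled by points of $P$. -}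

module Defs where

open import Data.Fin.Base as Fin using (Fin; toℕ)
open import Data.Fin.Properties using (+↔⊎; 1↔⊤)
open import Data.Integer.Base as ℤ using (ℤ; +_; 0ℤ; 1ℤ)
import Data.Integer.Properties as ℤ
open import Data.List.Base using (List; map; head; last; allFin)
open import Data.List.Relation.Binary.Subset.Propositional using (_⊆_)
open import Data.List.Relation.Ternary.Interleaving.Propositional using (Interleaving)
open import Data.List.Relation.Unary.Linked using (Linked)
open import Data.Maybe.Base using (just)
open import Data.Nat.Base as ℕ using (ℕ; zero; suc; _∸_)
open import Data.Nat.Combinatorics using (_C_)
open import Data.Product using (∃; ∃-syntax; ∃!; _×_; _,_; proj₁)
open import Data.Sum.Base using (_⊎_; inj₁; inj₂)
open import Data.Sum.Function.Propositional using (_⊎-↔_)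
import Data.Sum.Relation.Binary.LeftOrder as LeftOrder
open import Data.Sum.Relation.Binary.LeftOrder using (_⊎-<_)
import Data.Sum.Relation.Binary.Pointwise as Pointwise
open import Data.Sum.Relation.Binary.Pointwise
  using (Pointwise; ⊎-decidable; Pointwise-≡⇒≡; ≡⇒Pointwise-≡)
open import Data.Unit.Base using (⊤)
import Data.Unit.Properties as ⊤
open import Function.Base using (_∘_)
open import Function.Bundles using (Bijection; _↔_)
open import Function.Construct.Composition using (_↔-∘_)
open import Function.Construct.Symmetry using (↔-sym)
open import Level using (Level; 0ℓ; _⊔_) renaming (suc to lsuc)
open import Relation.Binary.Bundles using (Setoid)
open import Relation.Binary.Core using (Rel; _Preserves_⟶_)
import Relation.Binary.Construct.NonStrictToStrict as ToStrict
import Relation.Binary.Construct.On as On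
open import Relation.Binary.Definitions using (Decidable)
open import Relation.Binary.Morphism.Structures using (IsOrderIsomorphism)
open import Relation.Binary.PropositionalEquality as ≡ using (_≡_; refl; cong; _→-setoid_)
open import Relation.Binary.Structures using (IsPartialOrder; IsDecPartialOrder; IsDecTotalOrder)
open import Relation.Nullary using (¬_)
open import Relation.Nullary.Decidable using (map′)

open import Algebra.Properties.CommutativeMonoid.Sum ℤ.+-0-commutativeMonoid
  using (sum-syntax; sum⁺-syntax)

private
  variable
    a ℓ : Level

------------------------------------------------------------------------
-- Counting

-- Stated for an integer, because the coefficients below are integers.
HasCount : Setoid a ℓ → ℤ → Set (a ⊔ ℓ)
HasCount S z = ∃[ k ] (z ≡ + k × Bijection S (≡.setoid (Fin k)))

------------------------------------------------------------------------
-- Finite posets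

record FinitePoset : Set₁ where
  infix 4 _≤_ _<_
  field
    Carrier           : Set
    _≤_               : Rel Carrier 0ℓ
    isDecPartialOrder : IsDecPartialOrder _≡_ _≤_
    size              : ℕ
    enumeration       : Carrier ↔ Fin size

  open IsDecPartialOrder isDecPartialOrder public
    using (isPartialOrder; _≟_; _≤?_)

  _<_ : Rel Carrier 0ℓ
  _<_ = ToStrict._<_ _≡_ _≤_

  IsMinimal : Carrier → Set
  IsMinimal x = ∀ y → ¬ (y < x)

  IsMaximal : Carrier → Set
  IsMaximal x = ∀ y → ¬ (x < y)

  -- A finite chain is represented by the list of its elements in
  -- increasing order.
  IsChain : List Carrier → Set
  IsChain = Linked _<_

  IsMaximalChain : List Carrier → Set
  IsMaximalChain xs = IsChain xs × (∀ {ys} → IsChain ys → xs ⊆ ys → ys ⊆ xs)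

open FinitePoset using (Carrier; size; enumeration)

-- In these setoids proofs of membership are irrelevant.

MinimalPoints : FinitePoset → Setoid 0ℓ 0ℓ
MinimalPoints P = On.setoid (≡.setoid (Carrier P)) (proj₁ {B = IsMinimal})
  where open FinitePoset P using (IsMinimal)

MaximalPoints : FinitePoset → Setoid 0ℓ 0ℓ
MaximalPoints P = On.setoid (≡.setoid (Carrier P)) (proj₁ {B = IsMaximal})
  where open FinitePoset P using (IsMaximal)

MaximalChain : FinitePoset → Set
MaximalChain P = ∃ (FinitePoset.IsMaximalChain P)

MaximalChains : FinitePoset → Setoid 0ℓ 0ℓ
MaximalChains P =
  On.setoid (≡.setoid (List (Carrier P))) (proj₁ {B = FinitePoset.IsMaximalChain P})

infix 4 _≅_
_≅_ : FinitePoset → FinitePoset → Set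
P ≅ Q = ∃[ f ] IsOrderIsomorphism _≡_ _≡_ (FinitePoset._≤_ P) (FinitePoset._≤_ Q) f

------------------------------------------------------------------------
-- SP-posets

private
  ⊎-≟ : {A B : Set} → Decidable {A = A} _≡_ → Decidable {A = B} _≡_ →
        Decidable {A = A ⊎ B} _≡_
  ⊎-≟ _≟₁_ _≟₂_ x y = map′ Pointwise-≡⇒≡ ≡⇒Pointwise-≡ (⊎-decidable _≟₁_ _≟₂_ x y)

  -- The library orders on A ⊎ B are partial orders with respect to
  -- Pointwise _≡_ _≡_.
  ⊎-≡-isPartialOrder : {A B : Set} {_≤_ : Rel (A ⊎ B) 0ℓ} →
                       IsPartialOrder (Pointwise _≡_ _≡_) _≤_ → IsPartialOrder _≡_ _≤_
  ⊎-≡-isPartialOrder po = record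
    { isPreorder = record
      { isEquivalence = ≡.isEquivalence
      ; reflexive     = reflexive ∘ ≡⇒Pointwise-≡
      ; trans         = trans
      }
    ; antisym = λ x≤y y≤x → Pointwise-≡⇒≡ (antisym x≤y y≤x)
    }
    where open IsPartialOrder po

onePoint : FinitePoset
onePoint = record
  { Carrier           = ⊤
  ; _≤_               = _≡_
  ; isDecPartialOrder = IsDecTotalOrder.isDecPartialOrder ⊤.≡-isDecTotalOrder
  ; size              = 1
  ; enumeration       = ↔-sym 1↔⊤
  }

module _ (P Q : FinitePoset) where
  private
    module P = FinitePoset P
    module Q = FinitePoset Q

  disjointUnion : FinitePoset
  disjointUnion = record
    { Carrier           = P.Carrier ⊎ Q.Carrier
    ; _≤_               = Pointwise P._≤_ Q._≤_
    ; isDecPartialOrder = record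
      { isPartialOrder = ⊎-≡-isPartialOrder
                           (Pointwise.⊎-isPartialOrder P.isPartialOrder Q.isPartialOrder)
      ; _≟_            = ⊎-≟ P._≟_ Q._≟_
      ; _≤?_           = ⊎-decidable P._≤?_ Q._≤?_
      }
    ; size              = P.size ℕ.+ Q.size
    ; enumeration       = ↔-sym +↔⊎ ↔-∘ (P.enumeration ⊎-↔ Q.enumeration)
    }

  -- Every point of P lies below every point of Q.
  ordinalSum : FinitePoset
  ordinalSum = record
    { Carrier           = P.Carrier ⊎ Q.Carrier
    ; _≤_               = P._≤_ ⊎-< Q._≤_
    ; isDecPartialOrder = record
      { isPartialOrder = ⊎-≡-isPartialOrder
                           (LeftOrder.⊎-<-isPartialOrder P.isPartialOrder Q.isPartialOrder)
      ; _≟_            = ⊎-≟ P._≟_ Q._≟_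
      ; _≤?_           = LeftOrder.⊎-<-decidable P._≤?_ Q._≤?_
      }
    ; size              = P.size ℕ.+ Q.size
    ; enumeration       = ↔-sym +↔⊎ ↔-∘ (P.enumeration ⊎-↔ Q.enumeration)
    }

data IsSP : FinitePoset → Set₁ where
  point : IsSP onePoint
  union : ∀ {P Q} → IsSP P → IsSP Q → IsSP (disjointUnion P Q)
  sum   : ∀ {P Q} → IsSP P → IsSP Q → IsSP (ordinalSum P Q)
  iso   : ∀ {P Q} → P ≅ Q → IsSP P → IsSP Q

------------------------------------------------------------------------
-- The strict order polynomial and the integers d_{P,i}

-- The chain ⟨n⟩ is Fin n with its usual order.
StrictMaps : FinitePoset → ℕ → Setoid 0ℓ 0ℓ
StrictMaps P n =
  On.setoid (P.Carrier →-setoid Fin n) (proj₁ {B = λ f → f Preserves P._<_ ⟶ Fin._<_})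
  where module P = FinitePoset P

-- Ω°(P,n) = Σ_{i=1}^{|P|} d i · C(n,i) for all n.  This determines
-- d 1 , … , d |P| ; the other values of d are never used.
IsStrictOrderCoefficients : FinitePoset → (ℕ → ℤ) → Set
IsStrictOrderCoefficients P d =
  ∀ n → HasCount (StrictMaps P n)
                 (∑[ i < size P ] (d (suc (toℕ i)) ℤ.* + (n C suc (toℕ i))))

------------------------------------------------------------------------
-- Formal power series over ℤ

-- f n is the coefficient of xⁿ in f.
PowerSeries : Set
PowerSeries = ℕ → ℤ

infixl 7 _⊛_
infixr 8 _^_

_⊛_ : PowerSeries → PowerSeries → PowerSeries
(f ⊛ g) n = ∑[ k ≤ n ] (f (toℕ k) ℤ.* g (n ∸ toℕ k))

𝟙 : PowerSeries
𝟙 zero    = 1ℤ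
𝟙 (suc _) = 0ℤ

X : PowerSeries
X (suc zero) = 1ℤ
X _          = 0ℤ

_^_ : PowerSeries → ℕ → PowerSeries
f ^ zero  = 𝟙
f ^ suc k = f ⊛ f ^ k

-- 1 / (1 - x)
1/1-X : PowerSeries
1/1-X _ = 1ℤ

1/1-X-inverse : ∀ n → ((λ k → 𝟙 k ℤ.- X k) ⊛ 1/1-X) n ≡ 𝟙 n
1/1-X-inverse zero    = refl
1/1-X-inverse (suc n) = cong (λ z → 1ℤ ℤ.+ (ℤ.-1ℤ ℤ.+ z)) (zeros n)
  where
  zeros : ∀ m → ∑[ k < m ] 0ℤ ≡ 0ℤ
  zeros zero    = refl
  zeros (suc m) = ≡.trans (ℤ.+-identityˡ _) (zeros m)

-- x^{i+1} / (1 - x)^{i+1} is read as x^{i+1} · (1 / (1 - x))^{i+1}.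
lddSH : FinitePoset → (ℕ → ℤ) → PowerSeries
lddSH P d n = ∑[ i < size P ] (d (index i) ℤ.* (X ^ suc (index i) ⊛ 1/1-X ^ suc (index i)) n)
  where
  index : Fin (size P) → ℕ
  index i = suc (toℕ i)

------------------------------------------------------------------------
-- Shuffles of P and ⟨n⟩

record Shuffle (P : FinitePoset) (n : ℕ) : Set₁ where
  private module P = FinitePoset P
  field
    A     : FinitePoset
    label : Carrier A → P.Carrier ⊎ Fin n

    sameMinimal : Bijection (MinimalPoints A) (MinimalPoints P)
    sameMaximal : Bijection (MaximalPoints A) (MaximalPoints P)

    chainBijection : Bijection (MaximalChains P) (MaximalChains A)

  chainAlong : MaximalChain P → MaximalChain A
  chainAlong = Bijection.to chainBijection

  labelsAlong : MaximalChain P → List (P.Carrier ⊎ Fin n)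
  labelsAlong M = map label (proj₁ (chainAlong M))

  field
    -- The labels along A_M are M and 1 < ⋯ < n merged into one list, each
    -- element occurring once and both orders being kept.
    interleaves : ∀ M → Interleaving (map inj₁ (proj₁ M)) (map inj₂ (allFin n)) (labelsAlong M)

    labelsOnce : ∀ p → ∃! _≡_ λ x → label x ≡ inj₁ p

-- The maximal chain A_M is determined by M, its labels from P being those
-- in M, so only the label sequences are compared.
Shuffles : FinitePoset → ℕ → Setoid (lsuc 0ℓ) 0ℓ
Shuffles P n = record
  { Carrier       = Shuffle P n
  ; _≈_           = λ S T → ∀ M → Shuffle.labelsAlong S M ≡ Shuffle.labelsAlong T M
  ; isEquivalence = record
    { refl  = λ _ → refl
    ; sym   = λ S≈T M → ≡.sym (S≈T M)
    ; trans = λ S≈T T≈U M → ≡.trans (S≈T M) (T≈U M)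
    }
  }

module _ {P : FinitePoset} {n : ℕ} where

  FromP : Carrier P ⊎ Fin n → Set
  FromP l = ∃[ p ] l ≡ inj₁ p

  -- The minimum and maximum of a maximal chain are the head and the last
  -- element of the list representing it.
  record IsLeftDeckDivider (S : Shuffle P n) : Set where
    open Shuffle S
    field
      minimumFromDeck : ∀ ((m , _) : MaximalChain A) → ∃[ k ] head (map label m) ≡ just (inj₂ k)
      maximumFromDeck : ∀ ((m , _) : MaximalChain A) → ∃[ k ] last (map label m) ≡ just (inj₂ k)
      noConsecutive   : ∀ ((m , _) : MaximalChain A) →
                        Linked (λ x y → ¬ (FromP (label x) × FromP (label y))) m

LeftDeckDividerShuffles : FinitePoset → ℕ → Setoid (lsuc 0ℓ) 0ℓ
LeftDeckDividerShuffles P n =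
  On.setoid (Shuffles P n) (proj₁ {B = IsLeftDeckDivider {P} {n}})

{-# OPTIONS --safe #-}
module Submission where

-- The coefficient of xⁿ⁺¹ in (x / (1 - x))ⁱ⁺¹ is C(n,i), so the coefficient of
-- xᵐ⁺¹ in lddSH P d is the number of strict maps from P to ⟨m⟩.  A left
-- deck-divider shuffle S of P and ⟨m + 1⟩ gives such a map: send p to the gap
-- between two consecutive cards in which p lies.  The gap does not depend on
-- the maximal chain used to read it off, because two maximal chains of A
-- through the point labelled p can be exchanged above it, and the resulting
-- maximal chain also carries every card exactly once.  Conversely, a strict map
-- extends to the poset P̂ obtained from P by adding a bottom and a top; inserting
-- into each covering relation x ⋖ z of P̂ the cards between x and z, and then
-- deleting the bottom and the top, gives the shuffle.

open import Defs
import Algebra.Properties.CommutativeMonoid.Sum as CommutativeMonoidSum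
open import Data.Fin.Base as Fin using (Fin; zero; suc; toℕ; fromℕ; fromℕ<)
import Data.Fin.Properties as Fin
open import Data.Integer using (ℤ)
open import Data.Integer.Base as ℤ using (+_; 0ℤ; 1ℤ)
import Data.Integer.Properties as ℤ
open import Data.Irrelevant using ([_])
open import Data.List.Base using (List; []; _∷_; _++_; map; length; head; last; allFin; iterate; tabulate)
open import Data.List.Membership.Propositional using (_∈_)
open import Data.List.Membership.Propositional.Properties
  using (∈-++⁺ˡ; ∈-++⁺ʳ; ∈-++⁻; ∈-map⁺; ∈-map⁻; ∈-allFin)
open import Data.List.Properties
  using (∷-injectiveˡ; ∷-injectiveʳ; ++-identityʳ; length-++; length-tabulate; map-++; map-cong;
         map-injective; map-tabulate; tabulate-cong)
open import Data.List.Relation.Binary.Subset.Propositional using (_⊆_)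
open import Data.List.Relation.Ternary.Interleaving using (_∷ˡ_; _∷ʳ_)
open import Data.List.Relation.Ternary.Interleaving.Propositional using (Interleaving; [])
open import Data.List.Relation.Unary.All as All using (All; []; _∷_)
import Data.List.Relation.Unary.All.Properties as All
open import Data.List.Relation.Unary.AllPairs as AllPairs using (AllPairs; []; _∷_)
import Data.List.Relation.Unary.AllPairs.Properties as AllPairs
open import Data.List.Relation.Unary.Any using (here; there)
open import Data.List.Relation.Unary.Linked as Linked using (Linked; []; [-]; _∷_)
import Data.List.Relation.Unary.Linked.Properties as Linked
open import Data.Maybe.Base using (just)
open import Data.Nat using (ℕ)
open import Data.Nat.Base as ℕ using (zero; suc; _+_; _∸_; z≤n; s≤s)
open import Data.Nat.Combinatorics using (_C_; nCk+nC[k+1]≡[n+1]C[k+1])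
import Data.Nat.Properties as ℕ
open import Data.Product as Product using (∃; ∃!; ∃₂; ∃-syntax; _×_; _,_; <_,_>; proj₁; proj₂)
open import Data.Product.Function.NonDependent.Propositional using (_×-↔_)
open import Data.Refinement using (Refinement; value; _,_)
open import Data.Sum.Base as Sum using (_⊎_; inj₁; inj₂)
open import Data.Sum.Function.Propositional using (_⊎-↔_)
open import Data.Sum.Relation.Binary.LeftOrder using (₁∼₁; ₂∼₂; ₁∼₂)
open import Data.Unit.Base using (tt)
open import Function.Base using (_∘_; id)
open import Function.Bundles using (Bijection; Inverse; _↔_; mk↔ₛ′)
open import Function.Properties.Bijection using (Bijection⇒Inverse) renaming (trans to Bijection-trans)
open import Function.Properties.Inverse
  using (↔-refl; ↔-sym; ↔-trans; Inverse⇒Bijection) renaming (sym to Inverse-sym)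
import Relation.Binary.Construct.NonStrictToStrict as ToStrict
open import Relation.Binary.Core using (_Preserves_⟶_)
open import Relation.Binary.PropositionalEquality as ≡
  using (_≡_; _≢_; _≗_; refl; sym; trans; cong; cong₂; subst; subst₂; module ≡-Reasoning)
open import Relation.Binary.Structures using (IsPartialOrder)
open import Relation.Nullary using (¬_; Dec; yes; no; contradiction; recompute)
open import Relation.Nullary.Decidable using (_⊎-dec_; _×-dec_; ¬?; map′)
open import Relation.Nullary.Negation using (contradiction-irr)
open import Relation.Unary using (Decidable)

-- A word of labels is determined by its letters from the deck together with its list of gaps, and
-- the former are the same in every shuffle; comparing shuffles thus reduces to comparing gap
-- functions. The left deck-divider conditions translate separately: a card at the bottom makes gaps
-- positive, a card at the top keeps them below the number of cards, and the ban on consecutive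
-- points of `P` makes them strictly increasing along chains. With m + 1 cards exactly m gaps
-- remain, whence the shift between the index of the series and the argument of the strict order
-- polynomial.
--
-- Cards are inserted per covering relation, not per maximal chain: exchanging the upper parts of
-- two chains at a point of `P` then mirrors the same exchange in `P`, so no additional maximal
-- chains arise. The setoids of maximal chains and of extreme points ignore proofs, so the lists and
-- points constructed must not depend on them either; this is the reason for `Refinement` and for
-- the irrelevant arguments.

private
  module Σ = CommutativeMonoidSum ℤ.+-0-commutativeMonoid

-- The coefficients of the series

⊛-cong : ∀ {f f′ g g′} → f ≗ f′ → g ≗ g′ → f ⊛ g ≗ f′ ⊛ g′
⊛-cong f≗f′ g≗g′ n = Σ.sum-cong-≗ {suc n} λ k → cong₂ ℤ._*_ (f≗f′ (toℕ k)) (g≗g′ (n ∸ toℕ k))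

shift : PowerSeries → PowerSeries
shift f zero    = 0ℤ
shift f (suc n) = f n

𝟙-⊛ : ∀ f → 𝟙 ⊛ f ≗ f
𝟙-⊛ f n = trans (cong₂ ℤ._+_ (ℤ.*-identityˡ (f n)) (Σ.sum-replicate-zero n)) (ℤ.+-identityʳ (f n))

shift-⊛ : ∀ f g → shift f ⊛ g ≗ shift (f ⊛ g)
shift-⊛ f g zero    = refl
shift-⊛ f g (suc n) = ℤ.+-identityˡ ((f ⊛ g) n)

X≗shift-𝟙 : X ≗ shift 𝟙
X≗shift-𝟙 zero          = refl
X≗shift-𝟙 (suc zero)    = refl
X≗shift-𝟙 (suc (suc _)) = refl

X-⊛ : ∀ f → X ⊛ f ≗ shift f
X-⊛ f n = trans (⊛-cong {X} {shift 𝟙} {f} X≗shift-𝟙 (λ _ → refl) n) (trans (shift-⊛ 𝟙 f n) (shift-cong n))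
  where
  shift-cong : shift (𝟙 ⊛ f) ≗ shift f
  shift-cong zero    = refl
  shift-cong (suc n) = 𝟙-⊛ f n

X^suc-⊛ : ∀ k f → X ^ suc k ⊛ f ≗ shift (X ^ k ⊛ f)
X^suc-⊛ k f n = trans (⊛-cong {X ^ suc k} {shift (X ^ k)} {f} (X-⊛ (X ^ k)) (λ _ → refl) n) (shift-⊛ (X ^ k) f n)

1/1-X-⊛ : ∀ f n → (1/1-X ⊛ f) (suc n) ≡ f (suc n) ℤ.+ (1/1-X ⊛ f) n
1/1-X-⊛ f n = cong (ℤ._+ (1/1-X ⊛ f) n) (ℤ.*-identityˡ (f (suc n)))

-- The exponents are kept separate because the recursion below lowers the power of `1/1-X` alone;
-- only the diagonal occurs in `lddSH`.
deckSeries : ℕ → ℕ → PowerSeries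
deckSeries k l = X ^ k ⊛ 1/1-X ^ l

deckSeries-constant : ∀ k l → deckSeries k (suc l) 0 ≡ deckSeries k l 0
deckSeries-constant zero    l =
  trans (𝟙-⊛ (1/1-X ^ suc l) 0)
    (trans (ℤ.+-identityʳ (1ℤ ℤ.* (1/1-X ^ l) 0)) (sym (ℤ.+-identityʳ (1ℤ ℤ.* (1/1-X ^ l) 0))))
deckSeries-constant (suc k) l =
  trans (X^suc-⊛ k (1/1-X ^ suc l) 0) (sym (X^suc-⊛ k (1/1-X ^ l) 0))

-- Multiplication by `1/1-X` forms partial sums, so consecutive coefficients of the product differ
-- by one coefficient of the other factor; `X ^ k` only moves the index. `deckSeries-constant`
-- settles the index at which this shift runs out.
deckSeries-suc : ∀ k l n → deckSeries k (suc l) (suc n) ≡ deckSeries k l (suc n) ℤ.+ deckSeries k (suc l) n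
deckSeries-suc zero l n =
  trans (𝟙-⊛ (1/1-X ^ suc l) (suc n)) (trans (1/1-X-⊛ (1/1-X ^ l) n)
    (sym (cong₂ ℤ._+_ (𝟙-⊛ (1/1-X ^ l) (suc n)) (𝟙-⊛ (1/1-X ^ suc l) n))))
deckSeries-suc (suc k) l n =
  trans (X^suc-⊛ k (1/1-X ^ suc l) (suc n)) (trans (step n)
    (sym (cong₂ ℤ._+_ (X^suc-⊛ k (1/1-X ^ l) (suc n)) (X^suc-⊛ k (1/1-X ^ suc l) n))))
  where
  step : ∀ n → deckSeries k (suc l) n ≡ deckSeries k l n ℤ.+ shift (deckSeries k (suc l)) n
  step zero    = trans (deckSeries-constant k l) (sym (ℤ.+-identityʳ _))
  step (suc n) = deckSeries-suc k l n

deckSeries≡C : ∀ m k → deckSeries (suc k) (suc k) (suc m) ≡ + (m C k)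
deckSeries≡C m zero = trans (X^suc-⊛ 0 (1/1-X ^ 1) (suc m)) (trans (𝟙-⊛ (1/1-X ^ 1) m) (ones m))
  where
  ones : ∀ m → (1/1-X ^ 1) m ≡ 1ℤ
  ones zero    = refl
  ones (suc m) = trans (1/1-X-⊛ 𝟙 m) (trans (ℤ.+-identityˡ _) (ones m))
deckSeries≡C zero (suc k) =
  trans (X^suc-⊛ (suc k) (1/1-X ^ suc (suc k)) 1) (X^suc-⊛ k (1/1-X ^ suc (suc k)) 0)
deckSeries≡C (suc m) (suc k) =
  trans (X^suc-⊛ (suc k) (1/1-X ^ suc (suc k)) (suc (suc m)))
    (trans (deckSeries-suc (suc k) (suc k) m)
      -- Pascal's rule: the first summand is already on the diagonal, and the second returns to it
      -- when one more factor `X` is put back, which raises its index by one.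
      (trans (cong₂ ℤ._+_ (deckSeries≡C m k)
               (trans (sym (X^suc-⊛ (suc k) (1/1-X ^ suc (suc k)) (suc m))) (deckSeries≡C m (suc k))))
        (cong +_ (nCk+nC[k+1]≡[n+1]C[k+1] m k))))

lddSH-zero : ∀ P d → lddSH P d 0 ≡ 0ℤ
lddSH-zero P d =
  trans (Σ.sum-cong-≗ λ (i : Fin (FinitePoset.size P)) →
          trans (cong (d (suc (toℕ i)) ℤ.*_) (X^suc-⊛ (suc (toℕ i)) (1/1-X ^ suc (suc (toℕ i))) 0))
                (ℤ.*-zeroʳ (d (suc (toℕ i)))))
        (Σ.sum-replicate-zero (FinitePoset.size P))

lddSH-suc : ∀ P d m → lddSH P d (suc m) ≡
            Σ.sum {FinitePoset.size P} (λ i → d (suc (toℕ i)) ℤ.* + (m C suc (toℕ i)))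
lddSH-suc P d m = Σ.sum-cong-≗ λ (i : Fin (FinitePoset.size P)) →
  cong (d (suc (toℕ i)) ℤ.*_) (deckSeries≡C m (suc (toℕ i)))

-- Maximal chains of finite posets

module _ {A : Set} {R : A → A → Set} where

  ∈-pair : ∀ {xs x y} → AllPairs R xs → x ∈ xs → y ∈ xs → x ≡ y ⊎ R x y ⊎ R y x
  ∈-pair (_ ∷ _)  (here refl) (here refl) = inj₁ refl
  ∈-pair (Rx ∷ _) (here refl) (there y∈)  = inj₂ (inj₁ (All.lookup Rx y∈))
  ∈-pair (Ry ∷ _) (there x∈)  (here refl) = inj₂ (inj₂ (All.lookup Ry x∈))
  ∈-pair (_ ∷ Rs) (there x∈)  (there y∈)  = ∈-pair Rs x∈ y∈

  AllPairs-++⁻ˡ : ∀ xs {ys} → AllPairs R (xs ++ ys) → AllPairs R xs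
  AllPairs-++⁻ˡ []       _        = []
  AllPairs-++⁻ˡ (_ ∷ xs) (r ∷ rs) = All.++⁻ˡ xs r ∷ AllPairs-++⁻ˡ xs rs

  AllPairs-++⁻ʳ : ∀ xs {ys} → AllPairs R (xs ++ ys) → AllPairs R ys
  AllPairs-++⁻ʳ []       rs       = rs
  AllPairs-++⁻ʳ (_ ∷ xs) (_ ∷ rs) = AllPairs-++⁻ʳ xs rs

  AllPairs-++-∷⁻ : ∀ l {x u} → AllPairs R (l ++ x ∷ u) → All (λ y → R y x) l × All (R x) u
  AllPairs-++-∷⁻ []      (Rx ∷ _)  = [] , Rx
  AllPairs-++-∷⁻ (y ∷ l) (Ry ∷ Rs) = Product.map₁ (All.head (All.++⁻ʳ l Ry) ∷_) (AllPairs-++-∷⁻ l Rs)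

module Chains (Q : FinitePoset) where
  open FinitePoset Q public
  open IsPartialOrder isPartialOrder public
    using () renaming (refl to ≤-refl; trans to ≤-trans; antisym to ≤-antisym; reflexive to ≤-reflexive)

  Comparable : Carrier → Carrier → Set
  Comparable x y = x ≤ y ⊎ y ≤ x

  <-trans : ∀ {x y z} → x < y → y < z → x < z
  <-trans = ToStrict.<-trans _≡_ _≤_ isPartialOrder

  <-irrefl : ∀ {x} → ¬ (x < x)
  <-irrefl = ToStrict.<-irrefl _≡_ _≤_ refl

  <-asym : ∀ {x y} → x < y → ¬ (y < x)
  <-asym = ToStrict.<-asym _≡_ _≤_ ≤-antisym

  <⇒≱ : ∀ {x y} → x < y → ¬ (y ≤ x)
  <⇒≱ = ToStrict.<⇒≱ _≡_ _≤_ ≤-antisym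

  ≤-<-trans : ∀ {x y z} → x ≤ y → y < z → x < z
  ≤-<-trans x≤y (y≤z , y≢z) = ≤-trans x≤y y≤z , λ { refl → y≢z (≤-antisym y≤z x≤y) }

  <-≤-trans : ∀ {x y z} → x < y → y ≤ z → x < z
  <-≤-trans (x≤y , x≢y) y≤z = ≤-trans x≤y y≤z , λ { refl → x≢y (≤-antisym x≤y y≤z) }

  comparable? : ∀ x y → Dec (Comparable x y)
  comparable? x y = (x ≤? y) ⊎-dec (y ≤? x)

  chain⇒allPairs : ∀ {xs} → IsChain xs → AllPairs _<_ xs
  chain⇒allPairs = Linked.Linked⇒AllPairs <-trans

  chain⇒comparable : ∀ {xs x y} → IsChain xs → x ∈ xs → y ∈ xs → Comparable x y
  chain⇒comparable xs-chain x∈ y∈ with ∈-pair (chain⇒allPairs xs-chain) x∈ y∈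
  ... | inj₁ refl       = inj₁ ≤-refl
  ... | inj₂ (inj₁ x<y) = inj₁ (proj₁ x<y)
  ... | inj₂ (inj₂ y<x) = inj₂ (proj₁ y<x)

  sameElements⇒≡ : ∀ {xs ys} → IsChain xs → IsChain ys → xs ⊆ ys → ys ⊆ xs → xs ≡ ys
  sameElements⇒≡ xs-chain ys-chain = go (chain⇒allPairs xs-chain) (chain⇒allPairs ys-chain)
    where
    tail-⊆ : ∀ {x xs ys} → All (x <_) xs → (x ∷ xs) ⊆ (x ∷ ys) → xs ⊆ ys
    tail-⊆ x<xs sub z∈ with sub (there z∈)
    ... | here refl = contradiction (All.lookup x<xs z∈) <-irrefl
    ... | there z∈′ = z∈′

    go : ∀ {xs ys} → AllPairs _<_ xs → AllPairs _<_ ys → xs ⊆ ys → ys ⊆ xs → xs ≡ ys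
    go []         []         xs⊆ys ys⊆xs = refl
    go []         (_ ∷ _)    xs⊆ys ys⊆xs with ys⊆xs (here refl)
    ... | ()
    go (_ ∷ _)    []         xs⊆ys ys⊆xs with xs⊆ys (here refl)
    ... | ()
    go (x< ∷ xs<) (y< ∷ ys<) xs⊆ys ys⊆xs with xs⊆ys (here refl) | ys⊆xs (here refl)
    ... | here refl | _         = cong (_ ∷_) (go xs< ys< (tail-⊆ x< xs⊆ys) (tail-⊆ y< ys⊆xs))
    ... | there _   | here refl = cong (_ ∷_) (go xs< ys< (tail-⊆ x< xs⊆ys) (tail-⊆ y< ys⊆xs))
    ... | there x∈  | there y∈  = contradiction (All.lookup x< y∈) (<-asym (All.lookup y< x∈))

  -- The clause about arbitrary `p` serves the recursion itself: with `x <_` for `p`, it keeps the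
  -- head below the enlarged tail.
  insert : ∀ {xs} y → AllPairs _<_ xs → All (Comparable y) xs →
           ∃[ ys ] AllPairs _<_ ys × (∀ {p : Carrier → Set} → p y → All p xs → All p ys) × y ∈ ys × xs ⊆ ys
  insert y []         []       = y ∷ [] , [] ∷ [] , _∷_ , here refl , λ ()
  insert {x ∷ xs} y (x< ∷ xs<) (c ∷ cs) with y ≟ x | c
  ... | yes refl | _        = x ∷ xs , x< ∷ xs< , (λ _ ps → ps) , here refl , id
  ... | no  y≢x  | inj₁ y≤x =
    y ∷ x ∷ xs , (y<x ∷ All.map (<-trans y<x) x<) ∷ x< ∷ xs< , _∷_ , here refl , there
    where y<x = y≤x , y≢x
  ... | no  y≢x  | inj₂ x≤y with insert y xs< cs
  ...   | ys , ys< , all , y∈ , xs⊆ys =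
    x ∷ ys , all (x≤y , y≢x ∘ sym) x< ∷ ys< ,
    (λ { py (px ∷ pxs) → px ∷ all py pxs }) , there y∈ ,
    λ { (here refl) → here refl ; (there z∈) → there (xs⊆ys z∈) }

  -- Maximality tested one element at a time instead of against all larger chains, the form in which
  -- it is mostly proved and used below.
  Saturated : List Carrier → Set
  Saturated xs = ∀ y → All (Comparable y) xs → y ∈ xs

  maximal⇒saturated : ∀ {xs} → IsMaximalChain xs → Saturated xs
  maximal⇒saturated (xs-chain , max) y cs with insert y (chain⇒allPairs xs-chain) cs
  ... | ys , ys< , _ , y∈ , xs⊆ys = max (Linked.AllPairs⇒Linked ys<) xs⊆ys y∈

  saturated⇒maximal : ∀ {xs} → IsChain xs → Saturated xs → IsMaximalChain xs
  saturated⇒maximal xs-chain sat = xs-chain , λ ys-chain xs⊆ys {y} y∈ →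
    sat y (All.tabulate λ z∈ → chain⇒comparable ys-chain y∈ (xs⊆ys z∈))

  maximal-⊆⇒≡ : ∀ {xs ys} → IsMaximalChain xs → IsChain ys → xs ⊆ ys → xs ≡ ys
  maximal-⊆⇒≡ (xs-chain , max) ys-chain xs⊆ys =
    sameElements⇒≡ xs-chain ys-chain xs⊆ys (max ys-chain xs⊆ys)

  elements : List Carrier
  elements = map (Inverse.from enumeration) (allFin size)

  ∈-elements : ∀ x → x ∈ elements
  ∈-elements x = subst (_∈ elements) (Inverse.strictlyInverseʳ enumeration x)
    (∈-map⁺ (Inverse.from enumeration) (∈-allFin (Inverse.to enumeration x)))

  ∀? : ∀ {p} {Pr : Carrier → Set p} → Decidable Pr → Dec (∀ x → Pr x)
  ∀? {Pr = Pr} Pr? = map′ (λ all x → All.lookup all (∈-elements x)) (λ all → All.universal all elements)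
    (All.all? Pr? elements)

  extend : ∀ {xs} → IsChain xs → ∃[ ys ] IsMaximalChain ys × xs ⊆ ys
  extend xs-chain =
    let ys , ys< , xs⊆ys , sat = grow elements (chain⇒allPairs xs-chain)
    in  ys , saturated⇒maximal (Linked.AllPairs⇒Linked ys<) (λ y → sat (∈-elements y)) , xs⊆ys
    where
    grow : ∀ es {xs} → AllPairs _<_ xs →
           ∃[ ys ] AllPairs _<_ ys × xs ⊆ ys × (∀ {y} → y ∈ es → All (Comparable y) ys → y ∈ ys)
    grow []       {xs} xs< = xs , xs< , id , λ ()
    grow (e ∷ es) {xs} xs< with All.all? (comparable? e) xs
    ... | no  ¬cs =
      let ys , ys< , xs⊆ys , sat = grow es xs<
      in  ys , ys< , xs⊆ys , λ where
            -- `e` is incomparable with some member of `xs`, and that member remains in `ys`.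
            (here refl) cs → contradiction (All.tabulate (All.lookup cs ∘ xs⊆ys)) ¬cs
            (there y∈)  cs → sat y∈ cs
    ... | yes cs =
      let xs′ , xs′< , _ , e∈ , xs⊆xs′ = insert e xs< cs
          ys , ys< , xs′⊆ys , sat = grow es xs′<
      in  ys , ys< , xs′⊆ys ∘ xs⊆xs′ , λ where
            (here refl) _  → xs′⊆ys e∈
            (there y∈)  cs → sat y∈ cs

  maximalChainThrough : ∀ x → ∃[ M ] IsMaximalChain M × x ∈ M
  maximalChainThrough x = let M , M-max , sub = extend {x ∷ []} [-] in M , M-max , sub (here refl)

  -- An element `y` comparable with the whole spliced chain is comparable with `x`. If `y ≤ x`, it
  -- lies below all of `u₁` and so belongs to the first chain; if `x ≤ y`, it lies above all of `l₂`
  -- and so belongs to the second.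
  splice : ∀ l₁ {x u₁} l₂ {u₂} → IsMaximalChain (l₁ ++ x ∷ u₁) → IsMaximalChain (l₂ ++ x ∷ u₂) →
           IsMaximalChain (l₁ ++ x ∷ u₂)
  splice l₁ {x} {u₁} l₂ {u₂} max₁ max₂ = saturated⇒maximal (Linked.AllPairs⇒Linked spliced<) sat
    where
    chain₁ = chain⇒allPairs (proj₁ max₁)
    chain₂ = chain⇒allPairs (proj₁ max₂)
    l₁<x = proj₁ (AllPairs-++-∷⁻ l₁ chain₁)
    x<u₁ = proj₂ (AllPairs-++-∷⁻ l₁ chain₁)
    l₂<x = proj₁ (AllPairs-++-∷⁻ l₂ chain₂)
    x<u₂ = proj₂ (AllPairs-++-∷⁻ l₂ chain₂)

    spliced< : AllPairs _<_ (l₁ ++ x ∷ u₂)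
    spliced< = AllPairs.++⁺ (AllPairs-++⁻ˡ l₁ chain₁) (AllPairs-++⁻ʳ l₂ chain₂)
      (All.map (λ y<x → y<x ∷ All.map (<-trans y<x) x<u₂) l₁<x)

    sat : Saturated (l₁ ++ x ∷ u₂)
    sat y cs with y ≟ x | All.head (All.++⁻ʳ l₁ cs)
    ... | yes refl | _ = ∈-++⁺ʳ l₁ (here refl)
    ... | no  y≢x  | inj₁ y≤x with ∈-++⁻ l₁ (maximal⇒saturated max₁ y
                                 (All.++⁺ (All.++⁻ˡ l₁ cs)
                                          (inj₁ y≤x ∷ All.map (λ x<z → inj₁ (≤-trans y≤x (proj₁ x<z))) x<u₁)))
    ...   | inj₁ y∈         = ∈-++⁺ˡ y∈
    ...   | inj₂ (here y≡x) = contradiction y≡x y≢x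
    ...   | inj₂ (there y∈) = contradiction y≤x (<⇒≱ (All.lookup x<u₁ y∈))
    sat y cs | no y≢x | inj₂ x≤y with ∈-++⁻ l₂ (maximal⇒saturated max₂ y
                                 (All.++⁺ (All.map (λ z<x → inj₂ (≤-trans (proj₁ z<x) x≤y)) l₂<x)
                                          (All.++⁻ʳ l₁ cs)))
    ...   | inj₁ y∈ = contradiction x≤y (<⇒≱ (All.lookup l₂<x y∈))
    ...   | inj₂ y∈ = ∈-++⁺ʳ l₁ y∈

  infix 4 _⋖_
  _⋖_ : Carrier → Carrier → Set
  x ⋖ z = x < z × (∀ y → ¬ (x < y × y < z))

  _<?_ : ∀ x y → Dec (x < y)
  _<?_ = ToStrict.<-decidable _≡_ _≤_ _≟_ _≤?_

  _⋖?_ : ∀ x z → Dec (x ⋖ z)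
  x ⋖? z = (x <? z) ×-dec ∀? (λ y → ¬? ((x <? y) ×-dec (y <? z)))

  -- The density hypothesis is relative to the lower end `x`, so that it passes to tails. An element
  -- strictly between neighbours would be comparable with everything above it and hence already
  -- listed.
  covers : ∀ {x xs} → AllPairs _<_ (x ∷ xs) → (∀ y → x < y → All (Comparable y) xs → y ∈ xs) →
           Linked _⋖_ (x ∷ xs)
  covers {x} {[]}     _                  _     = [-]
  covers {x} {z ∷ xs} ((x<z ∷ _) ∷ z<xs ∷ xs<) dense = (x<z , nothingBetween) ∷ covers (z<xs ∷ xs<) dense′
    where
    nothingBetween : ∀ y → ¬ (x < y × y < z)
    nothingBetween y (x<y , y<z)
      with dense y x<y (inj₁ (proj₁ y<z) ∷ All.map (λ z<w → inj₁ (proj₁ (<-trans y<z z<w))) z<xs)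
    ... | here refl = <-irrefl y<z
    ... | there y∈  = <-asym y<z (All.lookup z<xs y∈)
    dense′ : ∀ y → z < y → All (Comparable y) xs → y ∈ xs
    dense′ y z<y cs with dense y (<-trans x<z z<y) (inj₂ (proj₁ z<y) ∷ cs)
    ... | here refl = contradiction z<y <-irrefl
    ... | there y∈  = y∈

-- Words in two alphabets

proj₁-determined : ∀ {A B : Set} (h : A → B) (ys : List (A × B)) → (∀ {a b} → (a , b) ∈ ys → b ≡ h a) →
                   ys ≡ map (λ a → a , h a) (map proj₁ ys)
proj₁-determined h []             _   = refl
proj₁-determined h ((a , b) ∷ ys) det =
  cong₂ _∷_ (cong (a ,_) (det (here refl))) (proj₁-determined h ys (det ∘ there))

∈-graph : ∀ {A B : Set} (h : A → B) xs {ab} → ab ∈ map < id , h > xs → proj₂ ab ≡ h (proj₁ ab)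
∈-graph h (_ ∷ _)  (here refl) = refl
∈-graph h (_ ∷ xs) (there ab∈) = ∈-graph h xs ab∈

module _ {P D : Set} where

  Word : Set
  Word = List (P ⊎ D)

  lefts : Word → List P
  lefts []            = []
  lefts (inj₁ p ∷ ws) = p ∷ lefts ws
  lefts (inj₂ _ ∷ ws) = lefts ws

  rights : Word → List D
  rights []            = []
  rights (inj₁ _ ∷ ws) = rights ws
  rights (inj₂ d ∷ ws) = d ∷ rights ws

  -- Pairs each p with c plus the number of letters from D before it.
  gaps : ℕ → Word → List (P × ℕ)
  gaps c []            = []
  gaps c (inj₁ p ∷ ws) = (p , c) ∷ gaps c ws
  gaps c (inj₂ _ ∷ ws) = gaps (suc c) ws

  NotBothLeft : P ⊎ D → P ⊎ D → Set
  NotBothLeft v w = ¬ ((∃ λ p → v ≡ inj₁ p) × (∃ λ p → w ≡ inj₁ p))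

  interleaving : ∀ ws → Interleaving (map inj₁ (lefts ws)) (map inj₂ (rights ws)) ws
  interleaving []            = []
  interleaving (inj₁ _ ∷ ws) = refl ∷ˡ interleaving ws
  interleaving (inj₂ _ ∷ ws) = refl ∷ʳ interleaving ws

  interleaving⇒projections : ∀ ps ds {ws} → Interleaving (map inj₁ ps) (map inj₂ ds) ws →
                             lefts ws ≡ ps × rights ws ≡ ds
  interleaving⇒projections []       []       []          = refl , refl
  interleaving⇒projections (p ∷ ps) []       (refl ∷ˡ i) =
    Product.map₁ (cong (p ∷_)) (interleaving⇒projections ps [] i)
  interleaving⇒projections []       (d ∷ ds) (refl ∷ʳ i) =
    Product.map₂ (cong (d ∷_)) (interleaving⇒projections [] ds i)
  interleaving⇒projections (p ∷ ps) (d ∷ ds) (refl ∷ˡ i) =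
    Product.map₁ (cong (p ∷_)) (interleaving⇒projections ps (d ∷ ds) i)
  interleaving⇒projections (p ∷ ps) (d ∷ ds) (refl ∷ʳ i) =
    Product.map₂ (cong (d ∷_)) (interleaving⇒projections (p ∷ ps) ds i)

  lefts-gaps : ∀ c ws → map proj₁ (gaps c ws) ≡ lefts ws
  lefts-gaps c []            = refl
  lefts-gaps c (inj₁ p ∷ ws) = cong (p ∷_) (lefts-gaps c ws)
  lefts-gaps c (inj₂ _ ∷ ws) = lefts-gaps (suc c) ws

  ∈-lefts : ∀ {ws p} → inj₁ p ∈ ws → p ∈ lefts ws
  ∈-lefts {_ ∷ _}      (here refl) = here refl
  ∈-lefts {inj₁ _ ∷ _} (there p∈)  = there (∈-lefts p∈)
  ∈-lefts {inj₂ _ ∷ _} (there p∈)  = ∈-lefts p∈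

  gaps-≥ : ∀ c ws {p k} → (p , k) ∈ gaps c ws → c ℕ.≤ k
  gaps-≥ c (inj₁ _ ∷ ws) (here refl) = ℕ.≤-refl
  gaps-≥ c (inj₁ _ ∷ ws) (there p∈)  = gaps-≥ c ws p∈
  gaps-≥ c (inj₂ _ ∷ ws) p∈          = ℕ.<⇒≤ (gaps-≥ (suc c) ws p∈)

  -- Where the words differ in kind, one has a letter from `P` in gap `c` while the other has
  -- already passed a letter from `D`, after which every gap exceeds `c`.
  gaps-rights-injective : ∀ c vs ws → gaps c vs ≡ gaps c ws → rights vs ≡ rights ws → vs ≡ ws
  gaps-rights-injective c []            []            _  _  = refl
  gaps-rights-injective c []            (inj₁ _ ∷ _)  () _
  gaps-rights-injective c []            (inj₂ _ ∷ _)  _  ()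
  gaps-rights-injective c (inj₁ _ ∷ _)  []            () _
  gaps-rights-injective c (inj₂ _ ∷ _)  []            _  ()
  gaps-rights-injective c (inj₁ p ∷ vs) (inj₁ q ∷ ws) eq rs =
    cong₂ (λ r → inj₁ r ∷_) (cong proj₁ (∷-injectiveˡ eq)) (gaps-rights-injective c vs ws (∷-injectiveʳ eq) rs)
  gaps-rights-injective c (inj₂ d ∷ vs) (inj₂ e ∷ ws) eq rs =
    cong₂ (λ r → inj₂ r ∷_) (∷-injectiveˡ rs) (gaps-rights-injective (suc c) vs ws eq (∷-injectiveʳ rs))
  gaps-rights-injective c (inj₁ p ∷ vs) (inj₂ e ∷ ws) eq rs =
    contradiction (gaps-≥ (suc c) ws (subst ((p , c) ∈_) eq (here refl))) ℕ.1+n≰n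
  gaps-rights-injective c (inj₂ d ∷ vs) (inj₁ q ∷ ws) eq rs =
    contradiction (gaps-≥ (suc c) vs (subst ((q , c) ∈_) (sym eq) (here refl))) ℕ.1+n≰n

  head-right⇒gap>0 : ∀ ws {d p k} → head ws ≡ just (inj₂ d) → (p , k) ∈ gaps 0 ws → 0 ℕ.< k
  head-right⇒gap>0 (inj₂ _ ∷ ws) refl p∈ = gaps-≥ 1 ws p∈

  gap>0⇒head-right : ∀ ws → 0 ℕ.< length (rights ws) → (∀ {p k} → (p , k) ∈ gaps 0 ws → 0 ℕ.< k) →
                     ∃ λ d → head ws ≡ just (inj₂ d)
  gap>0⇒head-right (inj₁ p ∷ ws) _ pos = contradiction (pos (here refl)) λ ()
  gap>0⇒head-right (inj₂ d ∷ ws) _ _   = d , refl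

  last-right⇒gap< : ∀ c ws {d p k} → last ws ≡ just (inj₂ d) → (p , k) ∈ gaps c ws → k ℕ.< c + length (rights ws)
  last-right⇒gap< c (inj₁ _ ∷ [])     () _
  last-right⇒gap< c (inj₂ _ ∷ [])     _  ()
  last-right⇒gap< c (inj₁ p ∷ w ∷ ws) eq (there p∈) = last-right⇒gap< c (w ∷ ws) eq p∈
  last-right⇒gap< c (inj₂ _ ∷ w ∷ ws) {k = k} eq p∈ =
    subst (k ℕ.<_) (sym (ℕ.+-suc c _)) (last-right⇒gap< (suc c) (w ∷ ws) eq p∈)
  last-right⇒gap< c (inj₁ p ∷ w ∷ ws) eq (here refl) = ℕ.m<m+n c (nonempty (w ∷ ws) eq)
    where
    nonempty : ∀ vs {d} → last vs ≡ just (inj₂ d) → 0 ℕ.< length (rights vs)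
    nonempty (inj₂ _ ∷ vs)     _  = s≤s z≤n
    nonempty (inj₁ _ ∷ v ∷ vs) eq = nonempty (v ∷ vs) eq

  gap<⇒last-right : ∀ c ws → 0 ℕ.< length ws → (∀ {p k} → (p , k) ∈ gaps c ws → k ℕ.< c + length (rights ws)) →
                    ∃ λ d → last ws ≡ just (inj₂ d)
  gap<⇒last-right c (inj₁ p ∷ [])     _ bound =
    contradiction (subst (c ℕ.<_) (ℕ.+-identityʳ c) (bound (here refl))) (ℕ.<-irrefl refl)
  gap<⇒last-right c (inj₂ d ∷ [])     _ _     = d , refl
  gap<⇒last-right c (inj₁ _ ∷ w ∷ ws) _ bound = gap<⇒last-right c (w ∷ ws) (s≤s z≤n) (bound ∘ there)
  gap<⇒last-right c (inj₂ _ ∷ w ∷ ws) _ bound =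
    gap<⇒last-right (suc c) (w ∷ ws) (s≤s z≤n) (λ {p} {k} p∈ → subst (k ℕ.<_) (ℕ.+-suc c _) (bound p∈))

  -- Two letters from `P` share a gap exactly when no letter from `D` separates them; the converse
  -- below rests on the same fact.
  notBothLeft⇒gaps< : ∀ c ws → Linked NotBothLeft ws → AllPairs (λ x y → proj₂ x ℕ.< proj₂ y) (gaps c ws)
  notBothLeft⇒gaps< c []                        _        = []
  notBothLeft⇒gaps< c (inj₁ _ ∷ [])             _        = [] ∷ []
  notBothLeft⇒gaps< c (inj₂ _ ∷ [])             _        = []
  notBothLeft⇒gaps< c (inj₁ p ∷ inj₁ q ∷ ws)    (r ∷ _)  = contradiction ((p , refl) , (q , refl)) r
  notBothLeft⇒gaps< c (inj₁ p ∷ inj₂ d ∷ ws)    (_ ∷ rs) =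
    All.tabulate (gaps-≥ (suc c) ws) ∷ notBothLeft⇒gaps< c (inj₂ d ∷ ws) rs
  notBothLeft⇒gaps< c (inj₂ d ∷ w ∷ ws)         (_ ∷ rs) = notBothLeft⇒gaps< (suc c) (w ∷ ws) rs

  gaps<⇒notBothLeft : ∀ c ws → AllPairs (λ x y → proj₂ x ℕ.< proj₂ y) (gaps c ws) → Linked NotBothLeft ws
  gaps<⇒notBothLeft c []                     _            = []
  gaps<⇒notBothLeft c (_ ∷ [])               _            = [-]
  gaps<⇒notBothLeft c (inj₁ p ∷ inj₁ q ∷ ws) ((c< ∷ _) ∷ _) = contradiction c< (ℕ.<-irrefl refl)
  gaps<⇒notBothLeft c (inj₁ p ∷ inj₂ d ∷ ws) (_ ∷ gs)     =
    (λ { (_ , _ , ()) }) ∷ gaps<⇒notBothLeft c (inj₂ d ∷ ws) gs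
  gaps<⇒notBothLeft c (inj₂ d ∷ w ∷ ws)      gs           =
    (λ { ((_ , ()) , _) }) ∷ gaps<⇒notBothLeft (suc c) (w ∷ ws) gs

  -- Locates an entry of the gap list at an actual point of `m`, so that `splice` can cut there; the
  -- gap becomes a count of the cards in the lower part.
  ∈-gaps-split : ∀ {A : Set} (label : A → P ⊎ D) c m {p k} → (p , k) ∈ gaps c (map label m) →
                 ∃ λ l → ∃₂ λ x u → m ≡ l ++ x ∷ u × label x ≡ inj₁ p × k ≡ c + length (rights (map label l))
  ∈-gaps-split label c (x ∷ m) p∈ with label x in eq
  ∈-gaps-split label c (x ∷ m) (here refl) | inj₁ _ = [] , x , m , refl , eq , sym (ℕ.+-identityʳ c)
  ∈-gaps-split label c (x ∷ m) (there p∈)  | inj₁ _ with ∈-gaps-split label c m p∈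
  ... | l , y , u , refl , y≡ , k≡ = x ∷ l , y , u , refl , y≡ ,
    trans k≡ (cong (λ w → c + length (rights (w ∷ map label l))) (sym eq))
  ∈-gaps-split label c (x ∷ m) p∈          | inj₂ d with ∈-gaps-split label (suc c) m p∈
  ... | l , y , u , refl , y≡ , k≡ = x ∷ l , y , u , refl , y≡ ,
    trans k≡ (trans (sym (ℕ.+-suc c _)) (cong (λ w → c + length (rights (w ∷ map label l))) (sym eq)))

  rights-++ : ∀ vs ws → rights (vs ++ ws) ≡ rights vs ++ rights ws
  rights-++ []            ws = refl
  rights-++ (inj₁ _ ∷ vs) ws = rights-++ vs ws
  rights-++ (inj₂ d ∷ vs) ws = cong (d ∷_) (rights-++ vs ws)

-- From shuffles to strict maps

module ShuffleGaps {P : FinitePoset} {n : ℕ} (S : Shuffle P n) where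
  open Shuffle S
  private
    module P = Chains P
    module A = Chains A

  lefts-labels : ∀ M → lefts (labelsAlong M) ≡ proj₁ M
  lefts-labels M = proj₁ (interleaving⇒projections (proj₁ M) (allFin n) (interleaves M))

  rights-labels : ∀ M → rights (labelsAlong M) ≡ allFin n
  rights-labels M = proj₂ (interleaving⇒projections (proj₁ M) (allFin n) (interleaves M))

  cards : List A.Carrier → ℕ
  cards xs = length (rights (map label xs))

  -- Surjectivity of `chainBijection` makes every maximal chain of `A` the image of one of `P`,
  -- including a spliced chain, which is not presented in that form.
  cards-maximal : ∀ {xs} → A.IsMaximalChain xs → cards xs ≡ n
  cards-maximal {xs} xs-max =
    let M , M≡ = Bijection.strictlySurjective chainBijection (xs , xs-max)
    in  trans (cong cards (sym M≡)) (trans (cong length (rights-labels M)) (length-tabulate {n = n} (λ i → i)))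

  cards-split : ∀ l {x u p} → label x ≡ inj₁ p → cards (l ++ x ∷ u) ≡ cards l + cards u
  cards-split l {x} {u} x≡ = begin
    length (rights (map label (l ++ x ∷ u)))                 ≡⟨ cong (length ∘ rights) (map-++ label l (x ∷ u)) ⟩
    length (rights (map label l ++ label x ∷ map label u))   ≡⟨ cong length (rights-++ (map label l) _) ⟩
    length (rights (map label l) ++ rights (label x ∷ map label u))
      ≡⟨ cong (λ w → length (rights (map label l) ++ rights (w ∷ map label u))) x≡ ⟩
    length (rights (map label l) ++ rights (map label u))    ≡⟨ length-++ (rights (map label l)) ⟩
    cards l + cards u                                        ∎
    where open ≡-Reasoning

  gap-unique : ∀ {xs ys p j k} → A.IsMaximalChain xs → A.IsMaximalChain ys →
               (p , j) ∈ gaps 0 (map label xs) → (p , k) ∈ gaps 0 (map label ys) → j ≡ k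
  gap-unique {xs} {ys} {p} xs-max ys-max j∈ k∈
    with ∈-gaps-split label 0 xs j∈ | ∈-gaps-split label 0 ys k∈
  ... | l₁ , x₁ , u₁ , refl , x₁≡ , refl | l₂ , x₂ , u₂ , refl , x₂≡ , refl
    -- By `labelsOnce` both occurrences of `p` are one point of `A`, where the chains can be
    -- spliced. The spliced chain and the second one then share `u₂`, whose cards cancel.
    with trans (sym (proj₂ (proj₂ (labelsOnce p)) x₁≡)) (proj₂ (proj₂ (labelsOnce p)) x₂≡)
  ... | refl = ℕ.+-cancelʳ-≡ (cards u₂) (cards l₁) (cards l₂) (begin
    cards l₁ + cards u₂       ≡⟨ cards-split l₁ x₁≡ ⟨
    cards (l₁ ++ x₁ ∷ u₂)     ≡⟨ cards-maximal (A.splice l₁ l₂ xs-max ys-max) ⟩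
    n                         ≡⟨ cards-maximal ys-max ⟨
    cards (l₂ ++ x₁ ∷ u₂)     ≡⟨ cards-split l₂ x₁≡ ⟩
    cards l₂ + cards u₂       ∎)
    where open ≡-Reasoning

  gapIn : ∀ M {p} → p ∈ proj₁ M → ∃ λ k → (p , k) ∈ gaps 0 (labelsAlong M)
  gapIn M {p} p∈
    with ∈-map⁻ proj₁ (subst (p ∈_) (sym (trans (lefts-gaps 0 (labelsAlong M)) (lefts-labels M))) p∈)
  ... | (_ , k) , k∈ , refl = k , k∈

  -- Read off along one chosen chain; `gaps-labels` shows that the choice is immaterial.
  gap : P.Carrier → ℕ
  gap p = let M , M-max , p∈ = P.maximalChainThrough p in proj₁ (gapIn (M , M-max) p∈)

  gaps-labels : ∀ M → gaps 0 (labelsAlong M) ≡ map (λ p → p , gap p) (proj₁ M)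
  gaps-labels M = trans (proj₁-determined gap _ gap-correct)
    (cong (map (λ p → p , gap p)) (trans (lefts-gaps 0 (labelsAlong M)) (lefts-labels M)))
    where
    gap-correct : ∀ {p k} → (p , k) ∈ gaps 0 (labelsAlong M) → k ≡ gap p
    gap-correct {p} k∈ = let M′ , M′-max , p∈ = P.maximalChainThrough p in
      gap-unique (proj₂ (chainAlong M)) (proj₂ (chainAlong (M′ , M′-max))) k∈ (proj₂ (gapIn (M′ , M′-max) p∈))

  gap-∈ : ∀ M {p} → p ∈ proj₁ M → (p , gap p) ∈ gaps 0 (labelsAlong M)
  gap-∈ M {p} p∈ = subst ((p , gap p) ∈_) (sym (gaps-labels M)) (∈-map⁺ (λ p → p , gap p) p∈)

  module _ (ldd : IsLeftDeckDivider S) where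
    open IsLeftDeckDivider ldd

    gap>0 : ∀ p → 0 ℕ.< gap p
    gap>0 p = let M , M-max , p∈ = P.maximalChainThrough p in
      head-right⇒gap>0 (labelsAlong (M , M-max)) (proj₂ (minimumFromDeck (chainAlong (M , M-max))))
        (gap-∈ (M , M-max) p∈)

    gap<n : ∀ p → gap p ℕ.< n
    gap<n p = let M , M-max , p∈ = P.maximalChainThrough p; A-chain = chainAlong (M , M-max) in
      subst (gap p ℕ.<_) (cards-maximal (proj₂ A-chain))
        (last-right⇒gap< 0 (labelsAlong (M , M-max)) (proj₂ (maximumFromDeck A-chain)) (gap-∈ (M , M-max) p∈))

    -- A maximal chain through `p` and `q` has increasing gaps in its own order; carrying `_<_`
    -- alongside excludes that `q` comes before `p`.
    gap-strict : ∀ {p q} → p P.< q → gap p ℕ.< gap q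
    gap-strict {p} {q} p<q with P.extend {p ∷ q ∷ []} (p<q ∷ [-])
    ... | M , M-max , pq⊆M = ordered
      (∈-pair (AllPairs.zip (P.chain⇒allPairs (proj₁ M-max) , gaps<)) (pq⊆M (here refl)) (pq⊆M (there (here refl))))
      where
      gaps< : AllPairs (λ p q → gap p ℕ.< gap q) M
      gaps< = AllPairs.map⁻ (subst (AllPairs (λ x y → proj₂ x ℕ.< proj₂ y)) (gaps-labels (M , M-max))
        (notBothLeft⇒gaps< 0 (labelsAlong (M , M-max))
          (Linked.map⁺ (noConsecutive (chainAlong (M , M-max))))))
      ordered : p ≡ q ⊎ (p P.< q × gap p ℕ.< gap q) ⊎ (q P.< p × gap q ℕ.< gap p) → gap p ℕ.< gap q
      ordered (inj₁ refl)             = contradiction p<q P.<-irrefl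
      ordered (inj₂ (inj₁ (_ , lt)))  = lt
      ordered (inj₂ (inj₂ (q<p , _))) = contradiction q<p (P.<-asym p<q)

open ShuffleGaps

-- Serves twice: with the gap function of another shuffle it gives congruence, and with a given
-- strict map it shows that the constructed shuffle returns that map.
gap-determined : ∀ {P n} (S : Shuffle P n) (h : FinitePoset.Carrier P → ℕ) →
                 (∀ M → gaps 0 (Shuffle.labelsAlong S M) ≡ map (λ p → p , h p) (proj₁ M)) →
                 ∀ p → gap S p ≡ h p
gap-determined {P} S h eq p = let M , M-max , p∈ = Chains.maximalChainThrough P p in
  ∈-graph h M (subst ((p , gap S p) ∈_) (eq (M , M-max)) (gap-∈ S (M , M-max) p∈))

gap-cong : ∀ {P n} (S T : Shuffle P n) → (∀ M → Shuffle.labelsAlong S M ≡ Shuffle.labelsAlong T M) →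
           ∀ p → gap S p ≡ gap T p
gap-cong S T S≈T = gap-determined S (gap T) λ M → trans (cong (gaps 0) (S≈T M)) (gaps-labels T M)

gap-injective : ∀ {P n} (S T : Shuffle P n) → (∀ p → gap S p ≡ gap T p) →
                ∀ M → Shuffle.labelsAlong S M ≡ Shuffle.labelsAlong T M
gap-injective S T same M = gaps-rights-injective 0 _ _
  (trans (gaps-labels S M) (trans (map-cong (λ p → cong (p ,_) (same p)) (proj₁ M)) (sym (gaps-labels T M))))
  (trans (rights-labels S M) (sym (rights-labels T M)))

-- The admissible gaps of `suc m` cards are 1, ..., `m`; the predecessor moves them to `Fin m`.
gapMap : ∀ {P m} (S : Shuffle P (suc m)) → IsLeftDeckDivider S → FinitePoset.Carrier P → Fin m
gapMap {m = m} S ldd p = fromℕ< (subst (ℕ._≤ m) (sym (ℕ.suc-pred (gap S p))) (ℕ.≤-pred (gap<n S ldd p)))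
  where instance _ = ℕ.>-nonZero (gap>0 S ldd p)

suc-gapMap : ∀ {P m} (S : Shuffle P (suc m)) (ldd : IsLeftDeckDivider S) p →
             suc (toℕ (gapMap S ldd p)) ≡ gap S p
suc-gapMap S ldd p = trans (cong suc (Fin.toℕ-fromℕ< _)) (ℕ.suc-pred (gap S p))
  where instance _ = ℕ.>-nonZero (gap>0 S ldd p)

gapMap-strict : ∀ {P m} (S : Shuffle P (suc m)) (ldd : IsLeftDeckDivider S) →
                gapMap S ldd Preserves FinitePoset._<_ P ⟶ Fin._<_
gapMap-strict S ldd p<q =
  ℕ.≤-pred (subst₂ ℕ._<_ (sym (suc-gapMap S ldd _)) (sym (suc-gapMap S ldd _)) (gap-strict S ldd p<q))

-- From strict maps to shuffles

-- Proofs in a `Refinement` are irrelevant, so elements are counted by their values, however many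
-- proofs of `R` there are.
Fin-refinement-finite : ∀ n {R : Fin n → Set} → Decidable R → ∃ λ k → Refinement (Fin n) R ↔ Fin k
Fin-refinement-finite zero    R? = 0 , mk↔ₛ′ value (λ ()) (λ ()) (λ { (() , _) })
Fin-refinement-finite (suc n) {R} R? with R? zero | Fin-refinement-finite n (R? ∘ suc)
... | no ¬r | k , numbering = k , mk↔ₛ′ to from (Inverse.strictlyInverseˡ numbering) from-to
  where
  to : Refinement (Fin (suc n)) R → Fin k
  to (zero  , [ r ]) = contradiction-irr r ¬r
  to (suc i , r)     = Inverse.to numbering (i , r)
  from : Fin k → Refinement (Fin (suc n)) R
  from j = let i , r = Inverse.from numbering j in suc i , r
  from-to : ∀ x → from (to x) ≡ x
  from-to (zero  , [ r ]) = contradiction-irr r ¬r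
  from-to (suc i , r)     = cong (λ { (i , r) → suc i , r }) (Inverse.strictlyInverseʳ numbering (i , r))
... | yes r | k , numbering = suc k , mk↔ₛ′ to from to-from from-to
  where
  to : Refinement (Fin (suc n)) R → Fin (suc k)
  to (zero  , _) = zero
  to (suc i , r) = suc (Inverse.to numbering (i , r))
  from : Fin (suc k) → Refinement (Fin (suc n)) R
  from zero    = zero , [ r ]
  from (suc j) = let i , r = Inverse.from numbering j in suc i , r
  to-from : ∀ j → to (from j) ≡ j
  to-from zero    = refl
  to-from (suc j) = cong suc (Inverse.strictlyInverseˡ numbering j)
  from-to : ∀ x → from (to x) ≡ x
  from-to (zero  , _) = refl
  from-to (suc i , r) = cong (λ { (i , r) → suc i , r }) (Inverse.strictlyInverseʳ numbering (i , r))

refinement-finite : ∀ {A : Set} {n} → A ↔ Fin n → {R : A → Set} → Decidable R → ∃ λ k → Refinement A R ↔ Fin k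
refinement-finite {A} {n} numbering {R} R? =
  let k , numbering′ = Fin-refinement-finite n (R? ∘ from) in k , ↔-trans reindex numbering′
  where
  open Inverse numbering
  Refinement-≡ : ∀ {B : Set} {T : B → Set} {x y : Refinement B T} → value x ≡ value y → x ≡ y
  Refinement-≡ refl = refl
  reindex : Refinement A R ↔ Refinement (Fin n) (R ∘ from)
  reindex = mk↔ₛ′
    (λ { (a , [ r ]) → to a , [ subst R (sym (strictlyInverseʳ a)) r ] })
    (λ { (i , r) → from i , r })
    (λ { (i , _) → Refinement-≡ (strictlyInverseˡ i) })
    (λ { (a , _) → Refinement-≡ (strictlyInverseʳ a) })

iterate-suc-++ : ∀ c a b → iterate suc c (a + b) ≡ iterate suc c a ++ iterate suc (c + a) b
iterate-suc-++ c zero    b = cong (λ c → iterate suc c b) (sym (ℕ.+-identityʳ c))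
iterate-suc-++ c (suc a) b = cong (c ∷_)
  (trans (iterate-suc-++ (suc c) a b) (cong (λ d → iterate suc (suc c) a ++ iterate suc d b) (sym (ℕ.+-suc c a))))

map-toℕ-allFin : ∀ n → map toℕ (allFin n) ≡ iterate suc 0 n
map-toℕ-allFin n = trans (map-tabulate {n = n} (λ i → i) toℕ) (from 0 n)
  where
  from : ∀ c n → tabulate {n = n} (λ i → c + toℕ i) ≡ iterate suc c n
  from c zero    = refl
  from c (suc n) = cong₂ _∷_ (ℕ.+-identityʳ c)
    (trans (tabulate-cong (λ i → ℕ.+-suc c (toℕ i))) (from (suc c) n))

pattern ⊥̂     = inj₁ tt
pattern ⟦_⟧ p = inj₂ (inj₁ p)
pattern ⊤̂     = inj₂ (inj₂ tt)

module Subdivision (P : FinitePoset) {m : ℕ} (g : FinitePoset.Carrier P → Fin m)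
                   (g-strict : g Preserves FinitePoset._<_ P ⟶ Fin._<_) where
  P̂ : FinitePoset
  P̂ = ordinalSum onePoint (ordinalSum P onePoint)

  module P = Chains P
  module P̂ = Chains P̂
  open P̂ using (_⋖_)

  ⟦⟧-≤ : ∀ {p q} → p P.≤ q → ⟦ p ⟧ P̂.≤ ⟦ q ⟧
  ⟦⟧-≤ p≤q = ₂∼₂ (₁∼₁ p≤q)

  ⟦⟧-≤⁻ : ∀ {p q} → ⟦ p ⟧ P̂.≤ ⟦ q ⟧ → p P.≤ q
  ⟦⟧-≤⁻ (₂∼₂ (₁∼₁ p≤q)) = p≤q

  ⟦⟧-injective : ∀ {p q} → _≡_ {A = P̂.Carrier} ⟦ p ⟧ ⟦ q ⟧ → p ≡ q
  ⟦⟧-injective refl = refl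

  ⟦⟧-< : ∀ {p q} → p P.< q → ⟦ p ⟧ P̂.< ⟦ q ⟧
  ⟦⟧-< (p≤q , p≢q) = ⟦⟧-≤ p≤q , p≢q ∘ ⟦⟧-injective

  ⟦⟧-<⁻ : ∀ {p q} → ⟦ p ⟧ P̂.< ⟦ q ⟧ → p P.< q
  ⟦⟧-<⁻ (p≤q , p≢q) = ⟦⟧-≤⁻ p≤q , λ { refl → p≢q refl }

  ⊥̂≤ : ∀ x → ⊥̂ P̂.≤ x
  ⊥̂≤ ⊥̂        = ₁∼₁ refl
  ⊥̂≤ (inj₂ _) = ₁∼₂

  ≤⊤̂ : ∀ x → x P̂.≤ ⊤̂
  ≤⊤̂ ⊥̂     = ₁∼₂
  ≤⊤̂ ⟦ _ ⟧ = ₂∼₂ ₁∼₂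
  ≤⊤̂ ⊤̂     = ₂∼₂ (₂∼₂ refl)

  -- The number of cards to be placed below a point. Cards are numbered from 0 and `p` comes right
  -- after card `g p`, hence the `suc`; the top has all `suc m` cards below it.
  height : P̂.Carrier → ℕ
  height ⊥̂     = 0
  height ⟦ p ⟧ = suc (toℕ (g p))
  height ⊤̂     = suc m

  height-≤ : ∀ x → height x ℕ.≤ suc m
  height-≤ ⊥̂     = z≤n
  height-≤ ⟦ p ⟧ = s≤s (ℕ.<⇒≤ (Fin.toℕ<n (g p)))
  height-≤ ⊤̂     = ℕ.≤-refl

  height-strict : ∀ {x y} → x P̂.< y → height x ℕ.< height y
  height-strict {⊥̂}     {⊥̂}     (_ , x≢y)               = contradiction refl x≢y
  height-strict {⊥̂}     {⟦ _ ⟧} _                       = s≤s z≤n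
  height-strict {⊥̂}     {⊤̂}     _                       = s≤s z≤n
  height-strict {⟦ p ⟧} {⟦ q ⟧} p<q                     = s≤s (g-strict (⟦⟧-<⁻ p<q))
  height-strict {⟦ p ⟧} {⊤̂}     _                       = s≤s (Fin.toℕ<n (g p))
  height-strict {⊤̂}     {⊤̂}     (_ , x≢y)               = contradiction refl x≢y
  height-strict {⟦ p ⟧} {⊥̂}     (() , _)
  height-strict {⊤̂}     {⊥̂}     (() , _)
  height-strict {⊤̂}     {⟦ _ ⟧} (₂∼₂ () , _)

  -- Card `k` on the edge from `x` to `z`. The range of `k` is half-open so that the edges along a
  -- maximal chain of `P̂` share out the cards 0, ..., `m` without overlap.
  IsSlot : P̂.Carrier × P̂.Carrier × Fin (suc m) → Set
  IsSlot (x , z , k) = x ⋖ z × height x ℕ.≤ toℕ k × toℕ k ℕ.< height z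

  isSlot? : Decidable IsSlot
  isSlot? (x , z , k) = (x P̂.⋖? z) ×-dec (height x ℕ.≤? toℕ k) ×-dec (toℕ k ℕ.<? height z)

  Slot : Set
  Slot = Refinement (P̂.Carrier × P̂.Carrier × Fin (suc m)) IsSlot

  isSlot : ∀ s → IsSlot (value s)
  isSlot (s , [ pf ]) = recompute (isSlot? s) pf

  Point : Set
  Point = P.Carrier ⊎ Slot

  -- The ends of the edge carrying a point. A point of `P` counts as a degenerate edge, which gives
  -- the order below one formula for all points.
  lo hi : Point → P̂.Carrier
  lo (inj₁ p)                 = ⟦ p ⟧
  lo (inj₂ ((x , _ , _) , _)) = x
  hi (inj₁ p)                 = ⟦ p ⟧
  hi (inj₂ ((_ , z , _) , _)) = z

  rank : Point → ℕ
  rank (inj₁ _)                 = 0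
  rank (inj₂ ((_ , _ , k) , _)) = toℕ k

  lo<hi : ∀ s → lo (inj₂ s) P̂.< hi (inj₂ s)
  lo<hi s = proj₁ (proj₁ (isSlot s))

  lo≤hi : ∀ a → lo a P̂.≤ hi a
  lo≤hi (inj₁ p) = P̂.≤-refl
  lo≤hi (inj₂ s) = proj₁ (lo<hi s)

  ⊥̂<hi : ∀ a → ⊥̂ P̂.< hi a
  ⊥̂<hi (inj₁ p) = ₁∼₂ , λ ()
  ⊥̂<hi (inj₂ s) = P̂.≤-<-trans (⊥̂≤ _) (lo<hi s)

  lo<⊤̂ : ∀ a → lo a P̂.< ⊤̂
  lo<⊤̂ (inj₁ p) = ₂∼₂ ₁∼₂ , λ ()
  lo<⊤̂ (inj₂ s) = P̂.<-≤-trans (lo<hi s) (≤⊤̂ _)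

  Point-≡ : ∀ {a b} → lo a ≡ lo b → hi a ≡ hi b → rank a ≡ rank b → a ≡ b
  Point-≡ {inj₁ p}                  {inj₁ q}                  refl _    _ = refl
  Point-≡ {inj₁ p}                  {inj₂ s}                  l    h    _ =
    contradiction (trans (sym l) h) (proj₂ (lo<hi s))
  Point-≡ {inj₂ s}                  {inj₁ q}                  l    h    _ =
    contradiction (trans l (sym h)) (proj₂ (lo<hi s))
  Point-≡ {inj₂ ((_ , _ , j) , _)} {inj₂ ((_ , _ , k) , _)} refl refl r with Fin.toℕ-injective r
  ... | refl = refl

  degenerate : ∀ {a p} → lo a ≡ ⟦ p ⟧ → hi a ≡ ⟦ p ⟧ → a ≡ inj₁ p
  degenerate {inj₁ q} refl _ = refl
  degenerate {inj₂ s} l    h = contradiction (trans l (sym h)) (proj₂ (lo<hi s))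

  rank-degenerate : ∀ a → lo a ≡ hi a → rank a ≡ 0
  rank-degenerate (inj₁ _) _  = refl
  rank-degenerate (inj₂ s) eq = contradiction eq (proj₂ (lo<hi s))

  infix 4 _≼_
  -- Cards on one edge form a chain; points on different edges are related only through a point of
  -- `P̂` lying weakly between the edges.
  _≼_ : Point → Point → Set
  a ≼ b = hi a P̂.≤ lo b ⊎ (lo a ≡ lo b × hi a ≡ hi b × rank a ℕ.≤ rank b)

  ≼-trans : ∀ {a b c} → a ≼ b → b ≼ c → a ≼ c
  ≼-trans {b = b} (inj₁ h) (inj₁ h′) = inj₁ (P̂.≤-trans h (P̂.≤-trans (lo≤hi b) h′))
  ≼-trans {a} (inj₁ h) (inj₂ (l , _)) = inj₁ (subst (hi a P̂.≤_) l h)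
  ≼-trans {c = c} (inj₂ (_ , h , _)) (inj₁ h′) = inj₁ (subst (P̂._≤ lo c) (sym h) h′)
  ≼-trans (inj₂ (l , h , r)) (inj₂ (l′ , h′ , r′)) = inj₂ (trans l l′ , trans h h′ , ℕ.≤-trans r r′)

  -- A cycle that uses the first alternative collapses both edges to a single point of `P̂`, so both
  -- are degenerate and have rank 0.
  ≼-antisym : ∀ {a b} → a ≼ b → b ≼ a → a ≡ b
  ≼-antisym (inj₂ (l , h , r)) (inj₂ (_ , _ , r′)) = Point-≡ l h (ℕ.≤-antisym r r′)
  ≼-antisym {a} {b} (inj₁ h) b≼a = Point-≡
    (P̂.≤-antisym (P̂.≤-trans (lo≤hi a) h) (proj₁ (≼⇒≤ b≼a)))
    (P̂.≤-antisym (P̂.≤-trans h (lo≤hi b)) (proj₂ (≼⇒≤ b≼a)))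
    (trans (rank-degenerate a lo≡hi) (sym (rank-degenerate b lo≡hi′)))
    where
    ≼⇒≤ : b ≼ a → lo b P̂.≤ lo a × hi b P̂.≤ hi a
    ≼⇒≤ (inj₁ h′)           = P̂.≤-trans (lo≤hi b) h′ , P̂.≤-trans h′ (lo≤hi a)
    ≼⇒≤ (inj₂ (l , h′ , _)) = P̂.≤-reflexive l , P̂.≤-reflexive h′
    lo≡hi : lo a ≡ hi a
    lo≡hi = P̂.≤-antisym (lo≤hi a) (P̂.≤-trans h (proj₁ (≼⇒≤ b≼a)))
    lo≡hi′ : lo b ≡ hi b
    lo≡hi′ = P̂.≤-antisym (lo≤hi b) (P̂.≤-trans (proj₂ (≼⇒≤ b≼a)) h)
  ≼-antisym {a} {b} (inj₂ (l , h , _)) (inj₁ h′) = Point-≡ l h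
    (trans (rank-degenerate a lo≡hi) (sym (rank-degenerate b (trans (sym l) (trans lo≡hi h)))))
    where
    lo≡hi : lo a ≡ hi a
    lo≡hi = P̂.≤-antisym (lo≤hi a) (subst (P̂._≤ lo a) (sym h) h′)

  _≼?_ : ∀ a b → Dec (a ≼ b)
  a ≼? b = (hi a P̂.≤? lo b) ⊎-dec ((lo a P̂.≟ lo b) ×-dec (hi a P̂.≟ hi b) ×-dec (rank a ℕ.≤? rank b))

  _≟_ : ∀ (a b : Point) → Dec (a ≡ b)
  a ≟ b = map′ (λ (l , h , r) → Point-≡ l h r) (λ { refl → refl , refl , refl })
    ((lo a P̂.≟ lo b) ×-dec (hi a P̂.≟ hi b) ×-dec (rank a ℕ.≟ rank b))

  slots-finite : ∃ λ k → Slot ↔ Fin k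
  slots-finite = refinement-finite
    (↔-trans (P̂.enumeration ×-↔ (P̂.enumeration ×-↔ ↔-refl))
      (↔-trans (↔-refl ×-↔ ↔-sym Fin.*↔×) (↔-sym Fin.*↔×)))
    isSlot?

  subdivision : FinitePoset
  subdivision = record
    { Carrier           = Point
    ; _≤_               = _≼_
    ; isDecPartialOrder = record
      { isPartialOrder = record
        { isPreorder = record
          { isEquivalence = ≡.isEquivalence
          ; reflexive     = λ { refl → inj₂ (refl , refl , ℕ.≤-refl) }
          ; trans         = λ {a} {b} {c} → ≼-trans {a} {b} {c}
          }
        ; antisym = ≼-antisym
        }
      ; _≟_  = _≟_
      ; _≤?_ = _≼?_
      }
    ; size              = P.size + proj₁ slots-finite
    ; enumeration       = ↔-trans (P.enumeration ⊎-↔ proj₂ slots-finite) (↔-sym Fin.+↔⊎)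
    }

  module A = Chains subdivision

  label : Point → P.Carrier ⊎ Fin (suc m)
  label (inj₁ p)                 = inj₁ p
  label (inj₂ ((_ , _ , k) , _)) = inj₂ k

  label-left : ∀ {a p} → label a ≡ inj₁ p → inj₁ p ≡ a
  label-left {inj₁ _} refl = refl

  labelsOnce : ∀ p → ∃! _≡_ λ a → label a ≡ inj₁ p
  labelsOnce p = inj₁ p , refl , λ {a} → label-left {a}

  -- Cards along an edge and along a chain

  below-height : ∀ z c {l} → c + suc l ≡ height z → c ℕ.< suc m
  below-height z c eq = ℕ.≤-trans (subst (c ℕ.<_) eq (ℕ.m<m+n c (s≤s z≤n))) (height-≤ z)

  segment-isSlot : ∀ {x z} c {l} → x ⋖ z → height x ℕ.≤ c → (eq : c + suc l ≡ height z) →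
                   IsSlot (x , z , fromℕ< (below-height z c eq))
  segment-isSlot {x} {z} c x⋖z x≤c eq =
    x⋖z , subst (height x ℕ.≤_) (sym c≡) x≤c ,
    subst (ℕ._< height z) (sym c≡) (subst (c ℕ.<_) eq (ℕ.m<m+n c (s≤s z≤n)))
    where c≡ = Fin.toℕ-fromℕ< (below-height z c eq)

  -- The cards `c`, ..., `c + l - 1`, with `l` as structural counter. All proofs are irrelevant, so
  -- the list depends only on the edge and the two numbers.
  segment : ∀ {x z} c l → .(x ⋖ z) → .(height x ℕ.≤ c) → .(c + l ≡ height z) → List Point
  segment         c zero    _   _   _  = []
  segment {x} {z} c (suc l) x⋖z x≤c eq =
    inj₂ ((x , z , fromℕ< (below-height z c eq)) , [ segment-isSlot c x⋖z x≤c eq ])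
    ∷ segment (suc c) l x⋖z (ℕ.m≤n⇒m≤1+n x≤c) (trans (sym (ℕ.+-suc c l)) eq)

  segment-All : ∀ {x z} c l .(x⋖z : x ⋖ z) .(x≤c : height x ℕ.≤ c) .(eq : c + l ≡ height z) →
                All (λ a → lo a ≡ x × hi a ≡ z × c ℕ.≤ rank a) (segment c l x⋖z x≤c eq)
  segment-All c zero    _   _   _  = []
  segment-All c (suc l) x⋖z x≤c eq =
    (refl , refl , ℕ.≤-reflexive (sym (Fin.toℕ-fromℕ< _))) ∷
    All.map (λ (l , h , r) → l , h , ℕ.<⇒≤ r) (segment-All (suc c) l x⋖z _ _)

  segment-< : ∀ {x z} c l .(x⋖z : x ⋖ z) .(x≤c : height x ℕ.≤ c) .(eq : c + l ≡ height z) →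
              AllPairs A._<_ (segment c l x⋖z x≤c eq)
  segment-< c zero    _   _   _  = []
  segment-< c (suc l) x⋖z x≤c eq =
    All.map (λ (l , h , r) →
        inj₂ (sym l , sym h , ℕ.≤-trans (ℕ.≤-reflexive (Fin.toℕ-fromℕ< _)) (ℕ.<⇒≤ r)) ,
        λ { refl → ℕ.<-irrefl (sym (Fin.toℕ-fromℕ< _)) r })
      (segment-All (suc c) l x⋖z _ _)
    ∷ segment-< (suc c) l x⋖z _ _

  segment-∈ : ∀ {x z} c l .(x⋖z : x ⋖ z) .(x≤c : height x ℕ.≤ c) .(eq : c + l ≡ height z) →
              ∀ a → lo a ≡ x → hi a ≡ z → c ℕ.≤ rank a → rank a ℕ.< c + l → a ∈ segment c l x⋖z x≤c eq
  segment-∈ c zero    x⋖z x≤c eq a _  _  c≤r r<c =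
    contradiction (ℕ.≤-trans r<c (ℕ.≤-reflexive (ℕ.+-identityʳ c))) (ℕ.≤⇒≯ c≤r)
  segment-∈ c (suc l) x⋖z x≤c eq a lo≡ hi≡ c≤r r<c with c ℕ.≟ rank a
  ... | yes c≡r = here (Point-≡ lo≡ hi≡ (trans (sym c≡r) (sym (Fin.toℕ-fromℕ< _))))
  ... | no  c≢r = there (segment-∈ (suc c) l x⋖z _ _ a lo≡ hi≡ (ℕ.≤∧≢⇒< c≤r c≢r)
                    (ℕ.≤-trans r<c (ℕ.≤-reflexive (ℕ.+-suc c l))))

  lefts-segment : ∀ {x z} c l .(x⋖z : x ⋖ z) .(x≤c : height x ℕ.≤ c) .(eq : c + l ≡ height z) → ∀ bs →
                  lefts (map label (segment c l x⋖z x≤c eq ++ bs)) ≡ lefts (map label bs)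
  lefts-segment c zero    x⋖z x≤c eq bs = refl
  lefts-segment c (suc l) x⋖z x≤c eq bs = lefts-segment (suc c) l x⋖z _ _ bs

  gaps-segment : ∀ {x z} c l .(x⋖z : x ⋖ z) .(x≤c : height x ℕ.≤ c) .(eq : c + l ≡ height z) → ∀ bs →
                 gaps c (map label (segment c l x⋖z x≤c eq ++ bs)) ≡ gaps (c + l) (map label bs)
  gaps-segment c zero    x⋖z x≤c eq bs = cong (λ c → gaps c (map label bs)) (sym (ℕ.+-identityʳ c))
  gaps-segment c (suc l) x⋖z x≤c eq bs =
    trans (gaps-segment (suc c) l x⋖z _ _ bs) (cong (λ c → gaps c (map label bs)) (sym (ℕ.+-suc c l)))

  rights-segment : ∀ {x z} c l .(x⋖z : x ⋖ z) .(x≤c : height x ℕ.≤ c) .(eq : c + l ≡ height z) → ∀ bs →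
                   map toℕ (rights (map label (segment c l x⋖z x≤c eq ++ bs))) ≡
                   iterate suc c l ++ map toℕ (rights (map label bs))
  rights-segment c zero    x⋖z x≤c eq bs = refl
  rights-segment c (suc l) x⋖z x≤c eq bs =
    cong₂ _∷_ (Fin.toℕ-fromℕ< _) (rights-segment (suc c) l x⋖z _ _ bs)

  height-∸ : ∀ {x z} → x ⋖ z → height x + (height z ∸ height x) ≡ height z
  height-∸ x⋖z = ℕ.m+[n∸m]≡n (ℕ.<⇒≤ (height-strict (proj₁ x⋖z)))

  edge : ∀ x z → .(x ⋖ z) → List Point
  edge x z x⋖z = segment (height x) (height z ∸ height x) x⋖z ℕ.≤-refl (height-∸ x⋖z)

  -- Only the top is adjoined. The lower end of the current edge is a separate argument of
  -- `subdivide`, starting at the bottom and moving up the chain.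
  bounded : List P.Carrier → List P̂.Carrier
  bounded []       = ⊤̂ ∷ []
  bounded (p ∷ ps) = ⟦ p ⟧ ∷ bounded ps

  -- Irrelevance of the last argument makes the list depend on x and ps alone,
  -- which chainBijection needs for congruence.
  subdivide : ∀ x ps → .(Linked _⋖_ (x ∷ bounded ps)) → List Point
  subdivide x []       cs = edge x ⊤̂ (Linked.head cs)
  subdivide x (p ∷ ps) cs = edge x ⟦ p ⟧ (Linked.head cs) ++ inj₁ p ∷ subdivide ⟦ p ⟧ ps (Linked.tail cs)

  ≤-<⇒A< : ∀ {a b} → hi a P̂.≤ lo b → lo a P̂.< hi b → a A.< b
  ≤-<⇒A< h l<h = inj₁ h , λ { refl → proj₂ l<h (P̂.≤-antisym (proj₁ l<h) h) }

  edge-All : ∀ {x z} (x⋖z : x ⋖ z) →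
             All (λ a → (x P̂.≤ lo a × x P̂.< hi a) × hi a P̂.≤ z × lo a P̂.< z) (edge x z x⋖z)
  edge-All {x} {z} x⋖z = All.map
    (λ (l , h , _) → (P̂.≤-reflexive (sym l) , subst (x P̂.<_) (sym h) (proj₁ x⋖z)) ,
                     P̂.≤-reflexive h , subst (P̂._< z) (sym l) (proj₁ x⋖z))
    (segment-All _ _ x⋖z _ _)

  subdivide-All : ∀ x ps (cs : Linked _⋖_ (x ∷ bounded ps)) →
                  All (λ a → x P̂.≤ lo a × x P̂.< hi a) (subdivide x ps cs)
  subdivide-All x []       (x⋖⊤ ∷ _)  = All.map proj₁ (edge-All x⋖⊤)
  subdivide-All x (p ∷ ps) (x⋖p ∷ cs) = All.++⁺ (All.map proj₁ (edge-All x⋖p))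
    ((proj₁ (proj₁ x⋖p) , proj₁ x⋖p) ∷
     All.map (λ (l , h) → P̂.≤-trans (proj₁ (proj₁ x⋖p)) l , P̂.<-trans (proj₁ x⋖p) h) (subdivide-All ⟦ p ⟧ ps cs))

  subdivide-< : ∀ x ps (cs : Linked _⋖_ (x ∷ bounded ps)) → AllPairs A._<_ (subdivide x ps cs)
  subdivide-< x []       (x⋖⊤ ∷ _)  = segment-< _ _ x⋖⊤ _ _
  subdivide-< x (p ∷ ps) (x⋖p ∷ cs) = AllPairs.++⁺
    (segment-< _ _ x⋖p _ _)
    (All.map (λ (l , h) → ≤-<⇒A< l h) later ∷ subdivide-< ⟦ p ⟧ ps cs)
    (All.map (λ (_ , hi≤p , lo<p) →
        ≤-<⇒A< hi≤p lo<p ∷ All.map (λ (l , h) → ≤-<⇒A< (P̂.≤-trans hi≤p l) (P̂.<-trans lo<p h)) later)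
      (edge-All x⋖p))
    where later = subdivide-All ⟦ p ⟧ ps cs

  module _ {x z} (x⋖z : x ⋖ z) (bs : List Point) where
    private
      l   = height z ∸ height x
      eq  = height-∸ x⋖z

    lefts-edge : lefts (map label (edge x z x⋖z ++ bs)) ≡ lefts (map label bs)
    lefts-edge = lefts-segment (height x) l x⋖z ℕ.≤-refl eq bs

    gaps-edge : gaps (height x) (map label (edge x z x⋖z ++ bs)) ≡ gaps (height z) (map label bs)
    gaps-edge = trans (gaps-segment (height x) l x⋖z ℕ.≤-refl eq bs) (cong (λ c → gaps c (map label bs)) eq)

    rights-edge : map toℕ (rights (map label (edge x z x⋖z ++ bs))) ≡
                  iterate suc (height x) l ++ map toℕ (rights (map label bs))
    rights-edge = rights-segment (height x) l x⋖z ℕ.≤-refl eq bs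

  lefts-subdivide : ∀ x ps (cs : Linked _⋖_ (x ∷ bounded ps)) → lefts (map label (subdivide x ps cs)) ≡ ps
  lefts-subdivide x []       (x⋖⊤ ∷ _)  =
    trans (cong (lefts ∘ map label) (sym (++-identityʳ (edge x ⊤̂ x⋖⊤)))) (lefts-edge x⋖⊤ [])
  lefts-subdivide x (p ∷ ps) (x⋖p ∷ cs) =
    trans (lefts-edge x⋖p (inj₁ p ∷ subdivide ⟦ p ⟧ ps cs)) (cong (p ∷_) (lefts-subdivide ⟦ p ⟧ ps cs))

  gaps-subdivide : ∀ x ps (cs : Linked _⋖_ (x ∷ bounded ps)) →
                   gaps (height x) (map label (subdivide x ps cs)) ≡ map (λ p → p , height ⟦ p ⟧) ps
  gaps-subdivide x []       (x⋖⊤ ∷ _)  =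
    trans (cong (gaps (height x) ∘ map label) (sym (++-identityʳ (edge x ⊤̂ x⋖⊤)))) (gaps-edge x⋖⊤ [])
  gaps-subdivide x (p ∷ ps) (x⋖p ∷ cs) =
    trans (gaps-edge x⋖p (inj₁ p ∷ subdivide ⟦ p ⟧ ps cs))
      (cong ((p , height ⟦ p ⟧) ∷_) (gaps-subdivide ⟦ p ⟧ ps cs))

  -- The card ranges of successive edges abut at the height of the shared point, so they concatenate
  -- to a single range.
  rights-subdivide : ∀ x ps (cs : Linked _⋖_ (x ∷ bounded ps)) →
                     map toℕ (rights (map label (subdivide x ps cs))) ≡ iterate suc (height x) (suc m ∸ height x)
  rights-subdivide x []       (x⋖⊤ ∷ _)  =
    trans (cong (map toℕ ∘ rights ∘ map label) (sym (++-identityʳ (edge x ⊤̂ x⋖⊤))))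
      (trans (rights-edge x⋖⊤ []) (++-identityʳ _))
  rights-subdivide x (p ∷ ps) (x⋖p ∷ cs) = begin
    map toℕ (rights (map label (edge x ⟦ p ⟧ x⋖p ++ inj₁ p ∷ subdivide ⟦ p ⟧ ps cs)))
      ≡⟨ rights-edge x⋖p (inj₁ p ∷ subdivide ⟦ p ⟧ ps cs) ⟩
    iterate suc hₓ (hₚ ∸ hₓ) ++ map toℕ (rights (map label (subdivide ⟦ p ⟧ ps cs)))
      ≡⟨ cong (iterate suc hₓ (hₚ ∸ hₓ) ++_) (rights-subdivide ⟦ p ⟧ ps cs) ⟩
    iterate suc hₓ (hₚ ∸ hₓ) ++ iterate suc hₚ (suc m ∸ hₚ)
      ≡⟨ cong (λ h → iterate suc hₓ (hₚ ∸ hₓ) ++ iterate suc h (suc m ∸ hₚ)) (height-∸ x⋖p) ⟨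
    iterate suc hₓ (hₚ ∸ hₓ) ++ iterate suc (hₓ + (hₚ ∸ hₓ)) (suc m ∸ hₚ)
      ≡⟨ iterate-suc-++ hₓ (hₚ ∸ hₓ) (suc m ∸ hₚ) ⟨
    iterate suc hₓ ((hₚ ∸ hₓ) + (suc m ∸ hₚ))
      ≡⟨ cong (iterate suc hₓ) (telescope (ℕ.<⇒≤ (height-strict (proj₁ x⋖p))) (height-≤ ⟦ p ⟧)) ⟩
    iterate suc hₓ (suc m ∸ hₓ) ∎
    where
    open ≡-Reasoning
    hₓ = height x
    hₚ = height ⟦ p ⟧
    telescope : ∀ {a b c} → a ℕ.≤ b → b ℕ.≤ c → (b ∸ a) + (c ∸ b) ≡ c ∸ a
    telescope {a} {b} {c} a≤b b≤c = trans (ℕ.+-comm (b ∸ a) (c ∸ b))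
      (trans (sym (ℕ.+-∸-assoc (c ∸ b) a≤b)) (cong (_∸ a) (ℕ.m∸n+n≡m b≤c)))

  ∈-subdivide : ∀ x {p ps} .(cs : Linked _⋖_ (x ∷ bounded ps)) → p ∈ ps → inj₁ p ∈ subdivide x ps cs
  ∈-subdivide x {ps = p ∷ ps} cs (here refl) = ∈-++⁺ʳ (edge x ⟦ p ⟧ (Linked.head cs)) (here refl)
  ∈-subdivide x {ps = p ∷ ps} cs (there p∈)  =
    ∈-++⁺ʳ (edge x ⟦ p ⟧ (Linked.head cs)) (there (∈-subdivide ⟦ p ⟧ (Linked.tail cs) p∈))

  -- Maximal chains of the subdivision

  Beside : Point → P̂.Carrier → Set
  Beside a y = y P̂.≤ lo a ⊎ hi a P̂.≤ y

  -- The covering relation leaves `hi a` no value but `z`, and `lo a` none but `x` or `z`; the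
  -- latter is the degenerate edge at `z`.
  inEdge : ∀ {x z} (x⋖z : x ⋖ z) a → x P̂.≤ lo a → x P̂.< hi a → hi a P̂.≤ z →
           a ∈ edge x z x⋖z ⊎ (lo a ≡ z × hi a ≡ z)
  inEdge {x} {z} x⋖z a x≤lo x<hi hi≤z with hi a P̂.≟ z
  ... | no hi≢z = contradiction (x<hi , hi≤z , hi≢z) (proj₂ x⋖z (hi a))
  inEdge {x} {z} x⋖z (inj₁ p) x≤lo x<hi hi≤z | yes hi≡z = inj₂ (hi≡z , hi≡z)
  inEdge {x} {z} x⋖z (inj₂ s) x≤lo x<hi hi≤z | yes refl with x P̂.≟ lo (inj₂ s)
  ... | no x≢lo = contradiction ((x≤lo , x≢lo) , lo<hi s) (proj₂ x⋖z (lo (inj₂ s)))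
  ... | yes refl = inj₁ (segment-∈ _ _ x⋖z _ _ (inj₂ s) refl refl (proj₁ (proj₂ (isSlot s)))
                     (subst (rank (inj₂ s) ℕ.<_) (sym (height-∸ x⋖z)) (proj₂ (proj₂ (isSlot s)))))

  -- Climb while the next vertex is at or below `lo a`; at the first one at or above `hi a`, or at
  -- the top, `inEdge` places `a`. `Beside` excludes any other position.
  covered : ∀ x ps (cs : Linked _⋖_ (x ∷ bounded ps)) a → x P̂.≤ lo a → x P̂.< hi a →
            All (λ p → Beside a ⟦ p ⟧) ps → a ∈ subdivide x ps cs
  covered x []       (x⋖⊤ ∷ _)  a x≤lo x<hi [] with inEdge x⋖⊤ a x≤lo x<hi (≤⊤̂ (hi a))
  ... | inj₁ a∈        = a∈
  ... | inj₂ (lo≡ , _) = contradiction lo≡ (proj₂ (lo<⊤̂ a))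
  covered x (p ∷ ps) (x⋖p ∷ cs) a x≤lo x<hi (inj₂ hi≤p ∷ bs) with inEdge x⋖p a x≤lo x<hi hi≤p
  ... | inj₁ a∈          = ∈-++⁺ˡ a∈
  ... | inj₂ (lo≡ , hi≡) = ∈-++⁺ʳ (edge x ⟦ p ⟧ x⋖p) (here (degenerate lo≡ hi≡))
  covered x (p ∷ ps) (x⋖p ∷ cs) a x≤lo x<hi (inj₁ p≤lo ∷ bs) with ⟦ p ⟧ P̂.≟ hi a
  ... | yes p≡hi = ∈-++⁺ʳ (edge x ⟦ p ⟧ x⋖p) (here (degenerate
                     (P̂.≤-antisym (subst (lo a P̂.≤_) (sym p≡hi) (lo≤hi a)) p≤lo) (sym p≡hi)))
  ... | no  p≢hi = ∈-++⁺ʳ (edge x ⟦ p ⟧ x⋖p)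
                     (there (covered ⟦ p ⟧ ps cs a p≤lo (P̂.≤-trans p≤lo (lo≤hi a) , p≢hi) bs))

  comparable⇒beside-lo : ∀ a b → A.Comparable a b → Beside b (lo a)
  comparable⇒beside-lo a b (inj₁ (inj₁ h))       = inj₁ (P̂.≤-trans (lo≤hi a) h)
  comparable⇒beside-lo a b (inj₁ (inj₂ (l , _))) = inj₁ (P̂.≤-reflexive l)
  comparable⇒beside-lo a b (inj₂ (inj₁ h))       = inj₂ h
  comparable⇒beside-lo a b (inj₂ (inj₂ (l , _))) = inj₁ (P̂.≤-reflexive (sym l))

  comparable⇒beside-hi : ∀ a b → A.Comparable a b → Beside b (hi a)
  comparable⇒beside-hi a b (inj₁ (inj₁ h))           = inj₁ h
  comparable⇒beside-hi a b (inj₁ (inj₂ (_ , h , _))) = inj₂ (P̂.≤-reflexive (sym h))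
  comparable⇒beside-hi a b (inj₂ (inj₁ h))           = inj₂ (P̂.≤-trans h (lo≤hi a))
  comparable⇒beside-hi a b (inj₂ (inj₂ (_ , h , _))) = inj₂ (P̂.≤-reflexive h)

  beside⇒comparable : ∀ {p} a → Beside a ⟦ p ⟧ → A.Comparable (inj₁ p) a
  beside⇒comparable a (inj₁ h) = inj₁ (inj₁ h)
  beside⇒comparable a (inj₂ h) = inj₂ (inj₁ h)

  bounded-⋖ : ∀ {M} → P.IsMaximalChain M → Linked _⋖_ (⊥̂ ∷ bounded M)
  bounded-⋖ {M} M-max = P̂.covers (⊥̂<bounded M ∷ bounded-< (P.chain⇒allPairs (proj₁ M-max))) dense
    where
    ⊥̂<bounded : ∀ ps → All (⊥̂ P̂.<_) (bounded ps)
    ⊥̂<bounded []       = (₁∼₂ , λ ()) ∷ []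
    ⊥̂<bounded (p ∷ ps) = (₁∼₂ , λ ()) ∷ ⊥̂<bounded ps
    bounded-All : ∀ {p ps} → All (p P.<_) ps → All (⟦ p ⟧ P̂.<_) (bounded ps)
    bounded-All []       = (₂∼₂ ₁∼₂ , λ ()) ∷ []
    bounded-All (r ∷ rs) = ⟦⟧-< r ∷ bounded-All rs
    bounded-< : ∀ {ps} → AllPairs P._<_ ps → AllPairs P̂._<_ (bounded ps)
    bounded-< []       = [] ∷ []
    bounded-< (r ∷ rs) = bounded-All r ∷ bounded-< rs
    comparable⁻ : ∀ {y} ps → All (P̂.Comparable ⟦ y ⟧) (bounded ps) → All (P.Comparable y) ps
    comparable⁻ []       _        = []
    comparable⁻ (p ∷ ps) (c ∷ cs) = Sum.map ⟦⟧-≤⁻ ⟦⟧-≤⁻ c ∷ comparable⁻ ps cs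
    ⊤̂∈bounded : ∀ ps → ⊤̂ ∈ bounded ps
    ⊤̂∈bounded []       = here refl
    ⊤̂∈bounded (p ∷ ps) = there (⊤̂∈bounded ps)
    ∈-bounded : ∀ {p ps} → p ∈ ps → ⟦ p ⟧ ∈ bounded ps
    ∈-bounded (here refl) = here refl
    ∈-bounded (there p∈)  = there (∈-bounded p∈)
    dense : ∀ y → ⊥̂ P̂.< y → All (P̂.Comparable y) (bounded M) → y ∈ bounded M
    dense ⊥̂     ⊥<⊥ _  = contradiction ⊥<⊥ P̂.<-irrefl
    dense ⟦ y ⟧ _   cs = ∈-bounded (P.maximal⇒saturated M-max y (comparable⁻ M cs))
    dense ⊤̂     _   _  = ⊤̂∈bounded M

  subdivideChain : ∀ M → .(P.IsMaximalChain M) → List Point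
  subdivideChain M M-max = subdivide ⊥̂ M (bounded-⋖ M-max)

  -- Comparability with the points of `M` already forces a point onto the chain, by `covered`.
  subdivideChain-maximal : ∀ M (M-max : P.IsMaximalChain M) → A.IsMaximalChain (subdivideChain M M-max)
  subdivideChain-maximal M M-max = A.saturated⇒maximal
    (Linked.AllPairs⇒Linked (subdivide-< ⊥̂ M cs))
    (λ a comp → covered ⊥̂ M cs a (⊥̂≤ (lo a)) (⊥̂<hi a)
      (All.tabulate λ {p} p∈ → comparable⇒beside-lo (inj₁ p) a (Sum.swap (All.lookup comp (∈-subdivide ⊥̂ cs p∈)))))
    where cs = bounded-⋖ M-max

  points : List Point → List P.Carrier
  points = lefts ∘ map label

  ∈-points⁻ : ∀ {p} xs → p ∈ points xs → inj₁ p ∈ xs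
  ∈-points⁻ (inj₁ _ ∷ _)  (here refl) = here refl
  ∈-points⁻ (inj₁ _ ∷ xs) (there p∈)  = there (∈-points⁻ xs p∈)
  ∈-points⁻ (inj₂ _ ∷ xs) p∈          = there (∈-points⁻ xs p∈)

  ∈-points⁺ : ∀ {p xs} → inj₁ p ∈ xs → p ∈ points xs
  ∈-points⁺ p∈ = ∈-lefts (∈-map⁺ label p∈)

  inj₁-<⁻ : ∀ {p q} → inj₁ p A.< inj₁ q → p P.< q
  inj₁-<⁻ (inj₁ h       , ne) = ⟦⟧-≤⁻ h , ne ∘ cong inj₁
  inj₁-<⁻ (inj₂ (l , _) , ne) = contradiction (cong inj₁ (⟦⟧-injective l)) ne

  points-< : ∀ {xs} → AllPairs A._<_ xs → AllPairs P._<_ (points xs)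
  points-< []                          = []
  points-< {inj₁ p ∷ xs} (p< ∷ xs<) = All.tabulate (inj₁-<⁻ ∘ All.lookup p< ∘ ∈-points⁻ xs) ∷ points-< xs<
  points-< {inj₂ s ∷ xs} (_  ∷ xs<) = points-< xs<

  module _ {xs} (xs-max : A.IsMaximalChain xs) where
    -- Whatever is comparable with `a` is comparable with the ends of its edge, so saturation puts
    -- those ends that lie in `P` on the chain.
    endpoint-∈ : ∀ {a q} → a ∈ xs → lo a ≡ ⟦ q ⟧ ⊎ hi a ≡ ⟦ q ⟧ → inj₁ q ∈ xs
    endpoint-∈ {a} {q} a∈ eq = A.maximal⇒saturated xs-max (inj₁ q)
      (All.tabulate λ {b} b∈ → beside⇒comparable b (beside b (A.chain⇒comparable (proj₁ xs-max) a∈ b∈) eq))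
      where
      beside : ∀ b → A.Comparable a b → lo a ≡ ⟦ q ⟧ ⊎ hi a ≡ ⟦ q ⟧ → Beside b ⟦ q ⟧
      beside b c (inj₁ l) = subst (Beside b) l (comparable⇒beside-lo a b c)
      beside b c (inj₂ h) = subst (Beside b) h (comparable⇒beside-hi a b c)

    -- An element comparable with all points of `P` on `xs` is comparable with the ends of every
    -- edge met by `xs`, by `endpoint-∈`. It cannot lie strictly inside an edge, whose ends form a
    -- covering relation; hence it is comparable with the cards too.
    points-maximal : P.IsMaximalChain (points xs)
    points-maximal = P.saturated⇒maximal
      (Linked.AllPairs⇒Linked (points-< (A.chain⇒allPairs (proj₁ xs-max)))) saturated
      where
      saturated : P.Saturated (points xs)
      saturated y comp = ∈-points⁺ (A.maximal⇒saturated xs-max (inj₁ y) (All.tabulate λ {a} a∈ →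
        beside⇒comparable a (beside a (endpoint-comparable (lo a) (endpoint-∈ a∈ ∘ inj₁))
                                      (endpoint-comparable (hi a) (endpoint-∈ a∈ ∘ inj₂)))))
        where
        endpoint-comparable : ∀ x → (∀ {q} → x ≡ ⟦ q ⟧ → inj₁ q ∈ xs) → P̂.Comparable ⟦ y ⟧ x
        endpoint-comparable ⊥̂     _ = inj₂ (⊥̂≤ ⟦ y ⟧)
        endpoint-comparable ⟦ q ⟧ q∈ = Sum.map ⟦⟧-≤ ⟦⟧-≤ (All.lookup comp (∈-points⁺ (q∈ refl)))
        endpoint-comparable ⊤̂     _ = inj₁ (≤⊤̂ ⟦ y ⟧)
        beside : ∀ a → P̂.Comparable ⟦ y ⟧ (lo a) → P̂.Comparable ⟦ y ⟧ (hi a) → Beside a ⟦ y ⟧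
        beside a        (inj₁ y≤lo) _           = inj₁ y≤lo
        beside a        (inj₂ _)    (inj₂ hi≤y) = inj₂ hi≤y
        beside (inj₁ p) (inj₂ p≤y)  (inj₁ _)    = inj₂ p≤y
        beside (inj₂ s) (inj₂ lo≤y) (inj₁ y≤hi)
          with lo (inj₂ s) P̂.≟ ⟦ y ⟧ | ⟦ y ⟧ P̂.≟ hi (inj₂ s)
        ... | yes lo≡y | _        = inj₁ (P̂.≤-reflexive (sym lo≡y))
        ... | no _     | yes y≡hi = inj₂ (P̂.≤-reflexive (sym y≡hi))
        ... | no lo≢y  | no y≢hi  =
          contradiction ((lo≤y , lo≢y) , (y≤hi , y≢hi)) (proj₂ (proj₁ (isSlot s)) ⟦ y ⟧)

    -- Inclusion suffices because `xs` is already maximal; each of its points is placed by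
    -- `covered`.
    subdivide-points : subdivideChain (points xs) points-maximal ≡ xs
    subdivide-points = sym (A.maximal-⊆⇒≡ xs-max (proj₁ (subdivideChain-maximal (points xs) points-maximal))
      λ {a} a∈ → covered ⊥̂ (points xs) (bounded-⋖ points-maximal) a (⊥̂≤ (lo a)) (⊥̂<hi a)
        (All.tabulate λ {p} p∈ →
          comparable⇒beside-lo (inj₁ p) a (A.chain⇒comparable (proj₁ xs-max) (∈-points⁻ xs p∈) a∈)))

  chainBijection : Bijection (MaximalChains P) (MaximalChains subdivision)
  chainBijection = record
    { to        = λ (M , M-max) → subdivideChain M M-max , subdivideChain-maximal M M-max
    ; cong      = λ { {M , M-max} {.M , _} refl → refl }
    ; bijective =
        (λ { {M , M-max} {M′ , M′-max} eq →
             trans (sym (lefts-subdivide ⊥̂ M (bounded-⋖ M-max)))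
               (trans (cong points eq) (lefts-subdivide ⊥̂ M′ (bounded-⋖ M′-max))) })
      -- A preimage may carry any proof of maximality; irrelevance in `subdivideChain` makes the
      -- resulting list the same.
      , (λ (xs , xs-max) → (points xs , points-maximal xs-max) ,
           λ { {M , M-max} refl → subdivide-points xs-max })
    }

  -- Minimal and maximal points of the subdivision

  covered-below : ∀ p → ∃ λ x → x ⋖ ⟦ p ⟧
  covered-below p = let M , M-max , p∈ = P.maximalChainThrough p in go (bounded-⋖ M-max) p∈
    where
    go : ∀ {x M} → Linked _⋖_ (x ∷ bounded M) → p ∈ M → ∃ λ x → x ⋖ ⟦ p ⟧
    go {x} (x⋖p ∷ _) (here refl) = x , x⋖p
    go (_ ∷ cs)      (there p∈)  = go cs p∈

  covered-above : ∀ p → ∃ λ z → ⟦ p ⟧ ⋖ z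
  covered-above p = let M , M-max , p∈ = P.maximalChainThrough p in go M (bounded-⋖ M-max) p∈
    where
    go : ∀ M {x} → Linked _⋖_ (x ∷ bounded M) → p ∈ M → ∃ λ z → ⟦ p ⟧ ⋖ z
    go (_ ∷ [])    (_ ∷ p⋖z ∷ _) (here refl) = ⊤̂ , p⋖z
    go (_ ∷ q ∷ _) (_ ∷ p⋖z ∷ _) (here refl) = ⟦ q ⟧ , p⋖z
    go (_ ∷ M)     (_ ∷ cs)      (there p∈)  = go M cs p∈

  -- Card `g p` is the last one below `p`, so it lies on every edge ending at `p`; likewise card
  -- `suc (g p)` begins every edge leaving `p`.
  below-isSlot : ∀ {x p} → x ⋖ ⟦ p ⟧ → IsSlot (x , ⟦ p ⟧ , Fin.inject₁ (g p))
  below-isSlot {x} {p} x⋖p =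
    x⋖p , subst (height x ℕ.≤_) (sym toℕ≡) (ℕ.≤-pred (height-strict (proj₁ x⋖p))) , s≤s (ℕ.≤-reflexive toℕ≡)
    where toℕ≡ = Fin.toℕ-inject₁ (g p)

  above-isSlot : ∀ {z p} → ⟦ p ⟧ ⋖ z → IsSlot (⟦ p ⟧ , z , suc (g p))
  above-isSlot p⋖z = p⋖z , ℕ.≤-refl , height-strict (proj₁ p⋖z)

  -- A point whose edge starts at `p` has the last card below `p` strictly beneath it.
  minimal⇒lo≢ : ∀ {a} → A.IsMinimal a → ∀ p → lo a ≢ ⟦ p ⟧
  minimal⇒lo≢ {a} min p lo≡ =
    let x , x⋖p = covered-below p
    in  min (inj₂ (_ , [ below-isSlot x⋖p ]))
          (≤-<⇒A< (P̂.≤-reflexive (sym lo≡)) (P̂.<-≤-trans (subst (x P̂.<_) (sym lo≡) (proj₁ x⋖p)) (lo≤hi a)))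

  maximal⇒hi≢ : ∀ {a} → A.IsMaximal a → ∀ p → hi a ≢ ⟦ p ⟧
  maximal⇒hi≢ {a} max p hi≡ =
    let z , p⋖z = covered-above p
    in  max (inj₂ (_ , [ above-isSlot p⋖z ]))
          (≤-<⇒A< (P̂.≤-reflexive hi≡) (P̂.≤-<-trans (lo≤hi a) (subst (P̂._< z) (sym hi≡) (proj₁ p⋖z))))

  minimal⇒⊥̂⋖ : ∀ {p} → P.IsMinimal p → ⊥̂ ⋖ ⟦ p ⟧
  minimal⇒⊥̂⋖ min = (₁∼₂ , λ ()) , λ where
    ⊥̂     (⊥<⊥ , _)      → P̂.<-irrefl ⊥<⊥
    ⟦ q ⟧ (_ , q<p)      → min q (⟦⟧-<⁻ q<p)
    ⊤̂     (_ , ₂∼₂ () , _)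

  maximal⇒⋖⊤̂ : ∀ {p} → P.IsMaximal p → ⟦ p ⟧ ⋖ ⊤̂
  maximal⇒⋖⊤̂ max = (₂∼₂ ₁∼₂ , λ ()) , λ where
    ⊥̂     ((() , _) , _)
    ⟦ q ⟧ (p<q , _)      → max q (⟦⟧-<⁻ p<q)
    ⊤̂     (_ , ⊤<⊤)      → P̂.<-irrefl ⊤<⊤

  ⊥̂⋖⇒minimal : ∀ {p} → ⊥̂ ⋖ ⟦ p ⟧ → P.IsMinimal p
  ⊥̂⋖⇒minimal (_ , none) q q<p = none ⟦ q ⟧ ((₁∼₂ , λ ()) , ⟦⟧-< q<p)

  ⋖⊤̂⇒maximal : ∀ {p} → ⟦ p ⟧ ⋖ ⊤̂ → P.IsMaximal p
  ⋖⊤̂⇒maximal (_ , none) q p<q = none ⟦ q ⟧ (⟦⟧-< p<q , (₂∼₂ ₁∼₂ , λ ()))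

  firstSlot : ∀ {p} → .(⊥̂ ⋖ ⟦ p ⟧) → Slot
  firstSlot {p} ⊥⋖p = (⊥̂ , ⟦ p ⟧ , zero) , [ ⊥⋖p , z≤n , s≤s z≤n ]

  lastSlot-isSlot : ∀ {p} → ⟦ p ⟧ ⋖ ⊤̂ → IsSlot (⟦ p ⟧ , ⊤̂ , fromℕ m)
  lastSlot-isSlot {p} p⋖⊤ =
    p⋖⊤ , subst (height ⟦ p ⟧ ℕ.≤_) (sym (Fin.toℕ-fromℕ m)) (Fin.toℕ<n (g p)) ,
    s≤s (ℕ.≤-reflexive (Fin.toℕ-fromℕ m))

  lastSlot : ∀ {p} → .(⟦ p ⟧ ⋖ ⊤̂) → Slot
  lastSlot {p} p⋖⊤ = (⟦ p ⟧ , ⊤̂ , fromℕ m) , [ lastSlot-isSlot p⋖⊤ ]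

  firstSlot-minimal : ∀ {p} .(⊥⋖p : ⊥̂ ⋖ ⟦ p ⟧) → A.IsMinimal (inj₂ (firstSlot ⊥⋖p))
  firstSlot-minimal _ b (inj₁ hi≤⊥          , _)  = P̂.<⇒≱ (⊥̂<hi b) hi≤⊥
  firstSlot-minimal _ b (inj₂ (l , h , r)   , ne) = ne (Point-≡ l h (ℕ.n≤0⇒n≡0 r))

  rank≤m : ∀ b → rank b ℕ.≤ m
  rank≤m (inj₁ _)                 = z≤n
  rank≤m (inj₂ ((_ , _ , k) , _)) = Fin.toℕ≤pred[n] k

  lastSlot-maximal : ∀ {p} .(p⋖⊤ : ⟦ p ⟧ ⋖ ⊤̂) → A.IsMaximal (inj₂ (lastSlot p⋖⊤))
  lastSlot-maximal _ b (inj₁ ⊤≤lo         , _)  = P̂.<⇒≱ (lo<⊤̂ b) ⊤≤lo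
  lastSlot-maximal _ b (inj₂ (l , h , r)  , ne) =
    ne (Point-≡ l h (ℕ.≤-antisym r (subst (rank b ℕ.≤_) (sym (Fin.toℕ-fromℕ m)) (rank≤m b))))

  module _ (p₀ : P.Carrier) where
    -- `p₀` separates the bottom from the top. An edge between them would have a first and a last
    -- card with no extreme point of `P` to match.
    ¬⊥̂⋖⊤̂ : ¬ (⊥̂ ⋖ ⊤̂)
    ¬⊥̂⋖⊤̂ (_ , none) = none ⟦ p₀ ⟧ ((₁∼₂ , λ ()) , (₂∼₂ ₁∼₂ , λ ()))

    minimal⇒firstSlot : ∀ a → A.IsMinimal a → ∃₂ λ p (⊥⋖p : ⊥̂ ⋖ ⟦ p ⟧) → a ≡ inj₂ (firstSlot ⊥⋖p)
    minimal⇒firstSlot (inj₁ p)                              min = contradiction refl (minimal⇒lo≢ min p)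
    minimal⇒firstSlot (inj₂ ((⟦ p ⟧ , _ , _) , _))          min = contradiction refl (minimal⇒lo≢ min p)
    minimal⇒firstSlot (inj₂ s@((⊤̂ , _ , _) , _))            min = contradiction (lo<⊤̂ (inj₂ s)) P̂.<-irrefl
    minimal⇒firstSlot (inj₂ s@((⊥̂ , ⊥̂ , _) , _))            min = contradiction (lo<hi s) P̂.<-irrefl
    minimal⇒firstSlot (inj₂ s@((⊥̂ , ⊤̂ , _) , _))            min = contradiction (proj₁ (isSlot s)) ¬⊥̂⋖⊤̂
    minimal⇒firstSlot (inj₂ s@((⊥̂ , ⟦ p ⟧ , zero) , _))     min = p , proj₁ (isSlot s) , refl
    minimal⇒firstSlot (inj₂ s@((⊥̂ , ⟦ p ⟧ , suc k) , _))    min =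
      contradiction (inj₂ (refl , refl , z≤n) , λ ()) (min (inj₂ (firstSlot (proj₁ (isSlot s)))))

    maximal⇒lastSlot : ∀ a → A.IsMaximal a → ∃₂ λ p (p⋖⊤ : ⟦ p ⟧ ⋖ ⊤̂) → a ≡ inj₂ (lastSlot p⋖⊤)
    maximal⇒lastSlot (inj₁ p)                           max = contradiction refl (maximal⇒hi≢ max p)
    maximal⇒lastSlot (inj₂ ((_ , ⟦ p ⟧ , _) , _))       max = contradiction refl (maximal⇒hi≢ max p)
    maximal⇒lastSlot (inj₂ s@((_ , ⊥̂ , _) , _))         max = contradiction (⊥̂<hi (inj₂ s)) P̂.<-irrefl
    maximal⇒lastSlot (inj₂ s@((⊤̂ , ⊤̂ , _) , _))         max = contradiction (lo<hi s) P̂.<-irrefl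
    maximal⇒lastSlot (inj₂ s@((⊥̂ , ⊤̂ , _) , _))         max = contradiction (proj₁ (isSlot s)) ¬⊥̂⋖⊤̂
    maximal⇒lastSlot (inj₂ s@((⟦ p ⟧ , ⊤̂ , k) , _))     max with k Fin.≟ fromℕ m
    ... | yes refl = p , proj₁ (isSlot s) , refl
    ... | no  k≢m  =
      contradiction (inj₂ (refl , refl , subst (toℕ k ℕ.≤_) (sym (Fin.toℕ-fromℕ m)) (rank≤m (inj₂ s))) ,
                     λ eq → k≢m (Fin.toℕ-injective (cong rank eq)))
                    (max (inj₂ (lastSlot (proj₁ (isSlot s)))))

    -- Constructed from `P` to the subdivision, where the first card on the edge from the bottom to
    -- `p` is an explicit value, and then inverted.
    sameMinimal : Bijection (MinimalPoints subdivision) (MinimalPoints P)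
    sameMinimal = Inverse⇒Bijection (Inverse-sym (Bijection⇒Inverse (record
      { to        = λ (p , min) → inj₂ (firstSlot (minimal⇒⊥̂⋖ min)) , firstSlot-minimal (minimal⇒⊥̂⋖ min)
      ; cong      = λ { refl → refl }
      ; bijective = (λ eq → ⟦⟧-injective (cong hi eq)) , λ (a , min) →
          let p , ⊥⋖p , a≡ = minimal⇒firstSlot a min
          in  (p , ⊥̂⋖⇒minimal ⊥⋖p) , λ { refl → sym a≡ }
      })))

    sameMaximal : Bijection (MaximalPoints subdivision) (MaximalPoints P)
    sameMaximal = Inverse⇒Bijection (Inverse-sym (Bijection⇒Inverse (record
      { to        = λ (p , max) → inj₂ (lastSlot (maximal⇒⋖⊤̂ max)) , lastSlot-maximal (maximal⇒⋖⊤̂ max)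
      ; cong      = λ { refl → refl }
      ; bijective = (λ eq → ⟦⟧-injective (cong lo eq)) , λ (a , max) →
          let p , p⋖⊤ , a≡ = maximal⇒lastSlot a max
          in  (p , ⋖⊤̂⇒maximal p⋖⊤) , λ { refl → sym a≡ }
      })))

    rights-subdivideChain : ∀ M M-max → rights (map label (subdivideChain M M-max)) ≡ allFin (suc m)
    rights-subdivideChain M M-max = map-injective Fin.toℕ-injective
      (trans (rights-subdivide ⊥̂ M (bounded-⋖ M-max)) (sym (map-toℕ-allFin (suc m))))

    shuffle : Shuffle P (suc m)
    shuffle = record
      { A              = subdivision
      ; label          = label
      ; sameMinimal    = sameMinimal
      ; sameMaximal    = sameMaximal
      ; chainBijection = chainBijection
      ; interleaves    = λ (M , M-max) →
          subst₂ (λ ps ds → Interleaving (map inj₁ ps) (map inj₂ ds) (map label (subdivideChain M M-max)))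
            (lefts-subdivide ⊥̂ M (bounded-⋖ M-max)) (rights-subdivideChain M M-max) (interleaving _)
      ; labelsOnce     = labelsOnce
      }

    -- The left deck-divider conditions for the constructed shuffle

    module _ {xs} (xs-max : A.IsMaximalChain xs) where
      private
        ws = map label xs

      rights-maximal : rights ws ≡ allFin (suc m)
      rights-maximal = trans (cong (rights ∘ map label) (sym (subdivide-points xs-max)))
        (rights-subdivideChain (points xs) (points-maximal xs-max))

      gaps-maximal : gaps 0 ws ≡ map (λ p → p , height ⟦ p ⟧) (points xs)
      gaps-maximal = trans (cong (gaps 0 ∘ map label) (sym (subdivide-points xs-max)))
        (gaps-subdivide ⊥̂ (points xs) (bounded-⋖ (points-maximal xs-max)))

      length-rights : length (rights ws) ≡ suc m
      length-rights = trans (cong length rights-maximal) (length-tabulate {n = suc m} id)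

      gap-height : ∀ {p k} → (p , k) ∈ gaps 0 ws → k ≡ height ⟦ p ⟧
      gap-height {p} {k} k∈ = ∈-graph (height ∘ ⟦_⟧) (points xs) (subst ((p , k) ∈_) gaps-maximal k∈)

      head-card : ∃ λ k → head ws ≡ just (inj₂ k)
      head-card = gap>0⇒head-right ws (subst (0 ℕ.<_) (sym length-rights) (s≤s z≤n))
        λ k∈ → subst (0 ℕ.<_) (sym (gap-height k∈)) (s≤s z≤n)

      last-card : ∃ λ k → last ws ≡ just (inj₂ k)
      last-card = gap<⇒last-right 0 ws (nonempty ws (proj₂ head-card))
        λ {p} k∈ → subst₂ ℕ._<_ (sym (gap-height k∈)) (sym length-rights) (s≤s (Fin.toℕ<n (g p)))
        where
        nonempty : ∀ vs {v} → head vs ≡ just v → 0 ℕ.< length vs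
        nonempty (_ ∷ _) _ = s≤s z≤n

      cards-between : Linked NotBothLeft ws
      cards-between = gaps<⇒notBothLeft 0 ws (subst (AllPairs (λ x y → proj₂ x ℕ.< proj₂ y)) (sym gaps-maximal)
        (AllPairs.map⁺ (AllPairs.map (λ p<q → s≤s (g-strict p<q))
          (P.chain⇒allPairs (proj₁ (points-maximal xs-max))))))

    shuffle-isLeftDeckDivider : IsLeftDeckDivider shuffle
    shuffle-isLeftDeckDivider = record
      { minimumFromDeck = head-card ∘ proj₂
      ; maximumFromDeck = last-card ∘ proj₂
      ; noConsecutive   = Linked.map⁻ ∘ cards-between ∘ proj₂
      }

    gaps-shuffle : ∀ M → gaps 0 (Shuffle.labelsAlong shuffle M) ≡ map (λ p → p , suc (toℕ (g p))) (proj₁ M)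
    gaps-shuffle (M , M-max) = gaps-subdivide ⊥̂ M (bounded-⋖ M-max)

-- Counting

-- Supplies the point that excludes an edge from bottom to top in the subdivision.
SP-inhabited : ∀ {P} → IsSP P → FinitePoset.Carrier P
SP-inhabited point         = tt
SP-inhabited (union sp _)  = inj₁ (SP-inhabited sp)
SP-inhabited (sum sp _)    = inj₁ (SP-inhabited sp)
SP-inhabited (iso (f , _) sp) = f (SP-inhabited sp)

shuffles⤖strictMaps : ∀ P → FinitePoset.Carrier P → ∀ m →
                      Bijection (LeftDeckDividerShuffles P (suc m)) (StrictMaps P m)
shuffles⤖strictMaps P p₀ m = record
  { to        = λ (S , ldd) → gapMap S ldd , gapMap-strict S ldd
  ; cong      = λ { {S , S-ldd} {T , T-ldd} S≈T p → Fin.toℕ-injective (ℕ.suc-injective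
      (trans (suc-gapMap S S-ldd p) (trans (gap-cong S T S≈T p) (sym (suc-gapMap T T-ldd p))))) }
  ; bijective =
      (λ { {S , S-ldd} {T , T-ldd} same → gap-injective S T λ p →
           trans (sym (suc-gapMap S S-ldd p)) (trans (cong (suc ∘ toℕ) (same p)) (suc-gapMap T T-ldd p)) })
    , λ (g , g-strict) → let open Subdivision P g g-strict in
        (shuffle p₀ , shuffle-isLeftDeckDivider p₀) , λ { {S , ldd} S≈shuffle p →
          Fin.toℕ-injective (ℕ.suc-injective (trans (suc-gapMap S ldd p)
            (gap-determined S (suc ∘ toℕ ∘ g) (λ M → trans (cong (gaps 0) (S≈shuffle M)) (gaps-shuffle p₀ M)) p))) }
  }

-- The empty chain extends to a maximal chain of `A`, whose lowest label would give an element of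
-- `Fin 0`.
noShuffles : ∀ {P} (S : Shuffle P 0) → ¬ IsLeftDeckDivider S
noShuffles S ldd
  with IsLeftDeckDivider.minimumFromDeck ldd
         (let m , m-max , _ = Chains.extend (Shuffle.A S) {[]} [] in m , m-max)
... | () , _

lemma3p20 : (P : FinitePoset) → IsSP P → (d : ℕ → ℤ) → IsStrictOrderCoefficients P d → (n : ℕ) → HasCount (LeftDeckDividerShuffles P n) (lddSH P d n)
lemma3p20 P sp d count zero = 0 , lddSH-zero P d , record
  { to        = λ (S , ldd) → contradiction ldd (noShuffles S)
  ; cong      = λ { {S , ldd} → contradiction ldd (noShuffles S) }
  ; bijective = (λ { {S , ldd} → contradiction ldd (noShuffles S) }) , λ ()
  }
lemma3p20 P sp d count (suc m) =
  -- `count` is taken at `m`, the number of admissible gaps among `suc m` cards.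
  let k , value , bijection = count m
  in  k , trans (lddSH-suc P d m) value , Bijection-trans (shuffles⤖strictMaps P (SP-inhabited sp) m) bijection
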